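{- The 2-MHV problem (the Maximum Happy Vertices problem with exactly $k=2$ colors) can be solved exactly in $O(m n^7 \log n)$ time, where $n=|V|$ and $m=|E|$ for the input graph $G=(V,E)$.
   Context: Maximum Happy Vertices problem (MHV): an instance consists of an undirected graph $G=(V,E)$, a color set $C=\{1,2,\ldots,k\}$, and a partial vertex coloring $c\colon V\to C$ (i.e. $c$ assigns colors to only part of the vertices). A total vertex coloring $c'\colon V\to C$ extends $c$ if it agrees with $c$ wherever $c$ is defined. Under a total coloring, a vertex is happy if it has the same color as all of its neighbors, and unhappy otherwise. The task is to find a total coloring extending $c$ that maximizes the number of happy vertices. For a constant $k$, the problem with the number of colors fixed to $k$ is denoted $k$-MHV. -}

module Defs where

open import Data.Bool using (if_then_else_)
open import Data.Fin using (Fin; toℕ; fromℕ<)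
open import Data.Fin.Properties using (all?; any?) renaming (_≟_ to _≟ᶠ_)
open import Data.List using (allFin; filter; length)
open import Data.Maybe using (Maybe; just; nothing)
open import Data.Nat using (ℕ; zero; suc; _+_; _∸_; _≤_; _<?_; _≟_)
open import Data.Product using (∃-syntax; _×_; _,_)
open import Data.Sum using (_⊎_)
open import Relation.Binary.PropositionalEquality using (_≡_; _≢_; refl)
open import Relation.Nullary using (Dec; yes; no; does; contradiction)
open import Relation.Nullary.Decidable using (_×-dec_; _⊎-dec_; _→-dec_)

------------------------------------------------------------------------
-- Maximum Happy Vertices

-- Finite simple graphs with vertex set Fin n and edge set Fin m. Each edge
-- stores its two endpoints in an arbitrary order.
record Graph (n m : ℕ) : Set where
  field
    end₁ end₂ : Fin m → Fin n

  Joins : Fin m → Fin n → Fin n → Set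
  Joins e u v = (end₁ e ≡ u × end₂ e ≡ v) ⊎ (end₁ e ≡ v × end₂ e ≡ u)

  field
    loopless   : ∀ e → end₁ e ≢ end₂ e
    noParallel : ∀ {e f u v} → Joins e u v → Joins f u v → e ≡ f

  Adjacent : Fin n → Fin n → Set
  Adjacent u v = ∃[ e ] Joins e u v

  adjacent? : ∀ u v → Dec (Adjacent u v)
  adjacent? u v = any? λ e →
    ((end₁ e ≟ᶠ u) ×-dec (end₂ e ≟ᶠ v)) ⊎-dec
    ((end₁ e ≟ᶠ v) ×-dec (end₂ e ≟ᶠ u))

PartialColoring : ℕ → ℕ → Set
PartialColoring k n = Fin n → Maybe (Fin k)

Coloring : ℕ → ℕ → Set
Coloring k n = Fin n → Fin k

Extends : ∀ {k n} → Coloring k n → PartialColoring k n → Set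
Extends c′ c = ∀ v i → c v ≡ just i → c′ v ≡ i

module _ {k n m : ℕ} (G : Graph n m) where
  open Graph G

  Happy : Coloring k n → Fin n → Set
  Happy c′ v = ∀ u → Adjacent v u → c′ u ≡ c′ v

  happy? : ∀ c′ v → Dec (Happy c′ v)
  happy? c′ v = all? λ u → adjacent? v u →-dec (c′ u ≟ᶠ c′ v)

  #happy : Coloring k n → ℕ
  #happy c′ = length (filter (happy? c′) (allFin n))

  IsOptimal : PartialColoring k n → Coloring k n → Set
  IsOptimal c c′ =
    Extends c′ c × (∀ c″ → Extends c″ c → #happy c″ ≤ #happy c′)

------------------------------------------------------------------------
-- Machine model: a unit-cost random-access machine in structured form.
--
-- Programs are while-programs over scalar variables and arrays of natural
-- numbers. A program mentions finitely many variables and arrays, so its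
-- storage interleaves into one RAM memory with constant-factor overhead.
-- The only arithmetic is addition and truncated subtraction; unit-cost
-- multiplication is excluded on purpose, being unrealistically strong on
-- unbounded integers.

data Expr : Set where
  lit     : ℕ → Expr
  var     : ℕ → Expr
  _[_]    : ℕ → Expr → Expr
  _⊕_ _⊖_ : Expr → Expr → Expr

infix  8 _[_]
infixl 7 _⊕_ _⊖_

data Prog : Set where
  skip            : Prog
  _≔_             : ℕ → Expr → Prog
  _[_]≔_          : ℕ → Expr → Expr → Prog
  _⨟_             : Prog → Prog → Prog
  ifnz_then_else_ : Expr → Prog → Prog → Prog
  whilenz_loop_   : Expr → Prog → Prog

infix  6 _≔_ _[_]≔_
infixr 4 _⨟_
infixr 5 ifnz_then_else_ whilenz_loop_

record State : Set where
  constructor state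
  field
    vars   : ℕ → ℕ
    arrays : ℕ → ℕ → ℕ

open State public

update : ∀ {A : Set} → (ℕ → A) → ℕ → A → ℕ → A
update f x a y = if does (x ≟ y) then a else f y

setVar : State → ℕ → ℕ → State
setVar σ x v = state (update (vars σ) x v) (arrays σ)

setArray : State → ℕ → ℕ → ℕ → State
setArray σ a i v =
  state (vars σ) (update (arrays σ) a (update (arrays σ a) i v))

eval : State → Expr → ℕ
eval σ (lit k)  = k
eval σ (var x)  = vars σ x
eval σ (a [ e ]) = arrays σ a (eval σ e)
eval σ (d ⊕ e)  = eval σ d + eval σ e
eval σ (d ⊖ e)  = eval σ d ∸ eval σ e

cost : Expr → ℕ
cost (lit k)  = 1
cost (var x)  = 1
cost (a [ e ]) = suc (cost e)
cost (d ⊕ e)  = suc (cost d + cost e)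
cost (d ⊖ e)  = suc (cost d + cost e)

-- ⟨ P , σ ⟩⇓⟨ σ′ , t ⟩: started in σ, the program P halts in σ′ after
-- exactly t steps. A test succeeds when its expression is non-zero.
data ⟨_,_⟩⇓⟨_,_⟩ : Prog → State → State → ℕ → Set where

  ⇓skip : ∀ {σ} → ⟨ skip , σ ⟩⇓⟨ σ , 1 ⟩

  ⇓var : ∀ {σ x e} →
    ⟨ x ≔ e , σ ⟩⇓⟨ setVar σ x (eval σ e) , suc (cost e) ⟩

  ⇓array : ∀ {σ a d e} →
    ⟨ a [ d ]≔ e , σ ⟩⇓⟨ setArray σ a (eval σ d) (eval σ e)
                       , suc (cost d + cost e) ⟩

  ⇓seq : ∀ {σ σ′ σ″ P Q s t} →
    ⟨ P , σ ⟩⇓⟨ σ′ , s ⟩ → ⟨ Q , σ′ ⟩⇓⟨ σ″ , t ⟩ →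
    ⟨ P ⨟ Q , σ ⟩⇓⟨ σ″ , s + t ⟩

  ⇓then : ∀ {σ σ′ e P Q t} → eval σ e ≢ 0 →
    ⟨ P , σ ⟩⇓⟨ σ′ , t ⟩ →
    ⟨ ifnz e then P else Q , σ ⟩⇓⟨ σ′ , suc (cost e + t) ⟩

  ⇓else : ∀ {σ σ′ e P Q t} → eval σ e ≡ 0 →
    ⟨ Q , σ ⟩⇓⟨ σ′ , t ⟩ →
    ⟨ ifnz e then P else Q , σ ⟩⇓⟨ σ′ , suc (cost e + t) ⟩

  ⇓loop : ∀ {σ σ′ σ″ e P s t} → eval σ e ≢ 0 →
    ⟨ P , σ ⟩⇓⟨ σ′ , s ⟩ → ⟨ whilenz e loop P , σ′ ⟩⇓⟨ σ″ , t ⟩ →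
    ⟨ whilenz e loop P , σ ⟩⇓⟨ σ″ , suc (cost e + (s + t)) ⟩

  ⇓exit : ∀ {σ e P} → eval σ e ≡ 0 →
    ⟨ whilenz e loop P , σ ⟩⇓⟨ σ , suc (cost e) ⟩

-- Hence the result and the running time are functions of program and input.
⇓-deterministic : ∀ {P σ σ₁ σ₂ t₁ t₂} →
  ⟨ P , σ ⟩⇓⟨ σ₁ , t₁ ⟩ → ⟨ P , σ ⟩⇓⟨ σ₂ , t₂ ⟩ → σ₁ ≡ σ₂ × t₁ ≡ t₂
⇓-deterministic ⇓skip ⇓skip = refl , refl
⇓-deterministic ⇓var ⇓var = refl , refl
⇓-deterministic ⇓array ⇓array = refl , refl
⇓-deterministic (⇓seq p q) (⇓seq p′ q′)
  with refl , refl ← ⇓-deterministic p p′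
  with refl , refl ← ⇓-deterministic q q′ = refl , refl
⇓-deterministic (⇓then _ p) (⇓then _ p′)
  with refl , refl ← ⇓-deterministic p p′ = refl , refl
⇓-deterministic (⇓then ≢0 _) (⇓else ≡0 _) = contradiction ≡0 ≢0
⇓-deterministic (⇓else ≡0 _) (⇓then ≢0 _) = contradiction ≡0 ≢0
⇓-deterministic (⇓else _ p) (⇓else _ p′)
  with refl , refl ← ⇓-deterministic p p′ = refl , refl
⇓-deterministic (⇓loop _ p q) (⇓loop _ p′ q′)
  with refl , refl ← ⇓-deterministic p p′
  with refl , refl ← ⇓-deterministic q q′ = refl , refl
⇓-deterministic (⇓loop ≢0 _ _) (⇓exit ≡0) = contradiction ≡0 ≢0
⇓-deterministic (⇓exit ≡0) (⇓loop ≢0 _ _) = contradiction ≡0 ≢0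
⇓-deterministic (⇓exit _) (⇓exit _) = refl , refl

------------------------------------------------------------------------
-- Input and output conventions
--
-- Input: variables 0 and 1 hold n and m; arrays 0 and 1 hold the first and
-- second endpoints of the edges; array 2 holds the partial colouring, where
-- 0 means uncoloured and the colours are 1, …, k. All other storage is 0.
-- Output: array 3 holds the total colouring, again with colours 1, …, k.

table : ∀ {n} → (Fin n → ℕ) → ℕ → ℕ
table {n} f i with i <? n
... | yes i<n = f (fromℕ< i<n)
... | no  _   = 0

colorCode : ∀ {k} → Fin k → ℕ
colorCode i = suc (toℕ i)

partialCode : ∀ {k} → Maybe (Fin k) → ℕ
partialCode nothing  = 0
partialCode (just i) = colorCode i

input : ∀ {k n m} → Graph n m → PartialColoring k n → State
input {k} {n} {m} G c = state inVars inArrays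
  where
  open Graph G

  inVars : ℕ → ℕ
  inVars 0 = n
  inVars 1 = m
  inVars _ = 0

  inArrays : ℕ → ℕ → ℕ
  inArrays 0 = table (λ e → toℕ (end₁ e))
  inArrays 1 = table (λ e → toℕ (end₂ e))
  inArrays 2 = table (λ v → partialCode (c v))
  inArrays _ = λ _ → 0

Outputs : ∀ {k n} → State → Coloring k n → Set
Outputs σ c′ = ∀ v → arrays σ 3 (toℕ v) ≡ colorCode (c′ v)

{-# OPTIONS --safe #-}
module Submission where

-- Say that u (to be happy in colour 1) conflicts with v (to be happy in colour
-- 2) if the precolouring permits either choice and their closed neighbourhoods
-- meet. Maximising happy vertices is then a maximum independent set problem in
-- the bipartite conflict graph, solved here by an auction: while some unmatched
-- left vertex u has a conflict of price at most n, it takes over a cheapest one,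
-- whose price goes up by 1. Prices never exceed n + 1, so there are at most
-- n (n + 1) bids. By pigeonhole some level k ≤ n is nobody's price. A matched
-- left vertex pays at most 1 more than its cheapest conflict, so no left
-- vertex mated above k conflicts with anything below k; the left vertices all
-- of whose conflicts lie above k and the permitted right vertices below k form
-- an independent set, and the matching certifies that it is maximum.

open import Defs
open import Data.Nat using (ℕ; _*_; _^_; _≤_)
open import Data.Nat.Logarithm using (⌊log₂_⌋)
open import Data.Product using (∃-syntax; _×_)

open import Algebra.Properties.CommutativeSemigroup using (x∙yz≈y∙xz)
open import Data.Bool using (T; true; false; not; _∧_)
open import Data.Fin using (Fin; zero; suc; toℕ; fromℕ<)
open import Data.Fin.Properties
  using (toℕ<n; toℕ-injective; toℕ-fromℕ<; fromℕ<-toℕ; fromℕ<-injective; injective⇒≤; pigeonhole)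
open import Data.List using (List; length; lookup; filter; allFin)
open import Data.List.Membership.Propositional using (_∈_)
open import Data.List.Membership.Propositional.Properties
  using (∈-filter⁺; ∈-filter⁻; ∈-allFin; ∈-lookup)
open import Data.List.Relation.Unary.All as All using ()
open import Data.List.Relation.Unary.AllPairs using (_∷_)
open import Data.List.Relation.Unary.Any as Any using ()
open import Data.List.Relation.Unary.Any.Properties using (lookup-index)
open import Data.List.Relation.Unary.Unique.Propositional using (Unique)
open import Data.List.Relation.Unary.Unique.Propositional.Properties using (allFin⁺; filter⁺)
open import Data.Maybe using (just)
open import Data.Nat hiding (ℕ; _*_; _^_; _≤_)
open import Data.Nat.Induction using (<-wellFounded)
open import Data.Nat.Logarithm using (⌊log₂⌋-mono-≤)
open import Data.Nat.Properties
open import Data.Product using (_,_; proj₁; proj₂)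
open import Data.Sum using (_⊎_; inj₁; inj₂)
open import Data.Unit using (⊤)
open import Function using (_∘_)
open import Induction.WellFounded using (Acc; acc)
open import Relation.Binary.PropositionalEquality
  using (_≡_; _≢_; refl; sym; trans; cong; cong₂; subst; ≢-sym)
open import Relation.Nullary using (¬_; yes; no; contradiction)
open import Relation.Nullary.Decidable using (dec-true; dec-false)
open import Relation.Unary using (Decidable)

-- Tests and their compilation

-- `levels` runs over the candidate prices 0, ..., n: one more than there are vertices, as the
-- pigeonhole argument requires.
data Range : Set where
  vertices edges levels : Range

bound : Range → Expr
bound vertices = var 0
bound edges    = var 1
bound levels   = var 0 ⊕ lit 1

size : Range → ℕ → ℕ → ℕ
size vertices n m = n
size edges    n m = m
size levels   n m = n + 1

infix  4 _≐_ _≼_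
infixr 3 _⋏_
infixr 2 _⋎_

data Test : Set where
  _≐_ _≼_ : Expr → Expr → Test
  _⋏_ _⋎_ : Test → Test → Test
  ∼_      : Test → Test
  some    : Range → Test → Test

infix 8 ∼_

-- In ⟦ φ ⟧ d and decide φ d, the outermost binder of φ is variable d, the
-- next one variable d + 1, and so on.
⟦_⟧ : Test → ℕ → State → Set
⟦ a ≐ b ⟧    d σ = eval σ a ≡ eval σ b
⟦ a ≼ b ⟧    d σ = eval σ a ≤ eval σ b
⟦ φ ⋏ ψ ⟧    d σ = ⟦ φ ⟧ d σ × ⟦ ψ ⟧ d σ
⟦ φ ⋎ ψ ⟧    d σ = ⟦ φ ⟧ d σ ⊎ ⟦ ψ ⟧ d σ
⟦ ∼ φ ⟧      d σ = ¬ ⟦ φ ⟧ d σ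
⟦ some r φ ⟧ d σ =
  ∃[ i ] i < size r (vars σ 0) (vars σ 1) × ⟦ φ ⟧ (suc d) (setVar σ d i)

-- Non-zero iff variable 2 is 0 and variable d is below the bound.
searching : Range → ℕ → Expr
searching r d = lit 1 ⊖ (var 2 ⊕ (lit 1 ⊖ (bound r ⊖ var d)))

-- The verdict is left in variable 2, as 0 or 1. Since the search stops at the
-- first success, witnesses of the leading quantifiers stay in their variables.
decide : Test → ℕ → Prog
decide (a ≐ b) d = 2 ≔ lit 1 ⊖ ((a ⊖ b) ⊕ (b ⊖ a))
decide (a ≼ b) d = 2 ≔ lit 1 ⊖ (a ⊖ b)
decide (φ ⋏ ψ) d = decide φ d ⨟ ifnz var 2 then decide ψ d else skip
decide (φ ⋎ ψ) d = decide φ d ⨟ ifnz var 2 then skip else decide ψ d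
decide (∼ φ)   d = decide φ d ⨟ 2 ≔ lit 1 ⊖ var 2
decide (some r φ) d =
  d ≔ lit 0 ⨟ 2 ≔ lit 0 ⨟ whilenz searching r d loop
    (decide φ (suc d) ⨟ ifnz var 2 then skip else d ≔ var d ⊕ lit 1)

-- A skipped second operand costs 3, an executed one 2 plus its own time. In a search, 4 pays for
-- the initialisations and 6 for the branch that advances the candidate. Costs do not depend on
-- which variable is read, so `searching r 0` stands for every depth.
time : Test → ℕ → ℕ → ℕ
time (a ≐ b) n m = suc (cost (lit 1 ⊖ ((a ⊖ b) ⊕ (b ⊖ a))))
time (a ≼ b) n m = suc (cost (lit 1 ⊖ (a ⊖ b)))
time (φ ⋏ ψ) n m = time φ n m + (3 + time ψ n m)
time (φ ⋎ ψ) n m = time φ n m + (3 + time ψ n m)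
time (∼ φ)   n m = time φ n m + 4
time (some r φ) n m =
  4 + (size r n m * (suc (cost (searching r 0)) + (time φ n m + 6))
       + suc (cost (searching r 0)))

-- Array 3 is reserved for the output and variable 2 for verdicts; tests read
-- neither.
Scopedᵉ : ℕ → Expr → Set
Scopedᵉ d (lit k)   = ⊤
Scopedᵉ d (var x)   = T ((x <ᵇ d) ∧ not (x ≡ᵇ 2))
Scopedᵉ d (a [ e ]) = T (not (a ≡ᵇ 3)) × Scopedᵉ d e
Scopedᵉ d (e ⊕ f)   = Scopedᵉ d e × Scopedᵉ d f
Scopedᵉ d (e ⊖ f)   = Scopedᵉ d e × Scopedᵉ d f

Scoped : ℕ → Test → Set
Scoped d (a ≐ b)    = Scopedᵉ d a × Scopedᵉ d b
Scoped d (a ≼ b)    = Scopedᵉ d a × Scopedᵉ d b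
Scoped d (φ ⋏ ψ)    = Scoped d φ × Scoped d ψ
Scoped d (φ ⋎ ψ)    = Scoped d φ × Scoped d ψ
Scoped d (∼ φ)      = Scoped d φ
Scoped d (some r φ) = Scoped (suc d) φ

-- Invariance of tests under changes outside their scope

record Agree (d : ℕ) (σ τ : State) : Set where
  constructor agree
  field
    sameVars   : ∀ {x} → x < d → x ≢ 2 → vars σ x ≡ vars τ x
    sameArrays : ∀ {a} → a ≢ 3 → arrays σ a ≡ arrays τ a

open Agree

agree-sym : ∀ {d σ τ} → Agree d σ τ → Agree d τ σ
agree-sym (agree v a) = agree (λ p q → sym (v p q)) (λ p → sym (a p))

agree-trans : ∀ {d σ τ υ} → Agree d σ τ → Agree d τ υ → Agree d σ υ
agree-trans (agree v a) (agree w b) =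
  agree (λ p q → trans (v p q) (w p q)) (λ p → trans (a p) (b p))

update-same : ∀ {A : Set} (f : ℕ → A) x a → update f x a x ≡ a
update-same f x a rewrite dec-true (x ≟ x) refl = refl

update-other : ∀ {A : Set} (f : ℕ → A) {x y} a → x ≢ y → update f x a y ≡ f y
update-other f {x} {y} a x≢y rewrite dec-false (x ≟ y) x≢y = refl

agree-bind : ∀ {d σ τ i j} → Agree d σ τ → i ≡ j →
             Agree (suc d) (setVar σ d i) (setVar τ d j)
agree-bind {d} {σ} {τ} {i} (agree v a) refl = agree w a
  where
  w : ∀ {x} → x < suc d → x ≢ 2 →
      vars (setVar σ d i) x ≡ vars (setVar τ d i) x
  w {x} x≤d x≢2 with d ≟ x
  ... | yes refl rewrite update-same (vars σ) d i | update-same (vars τ) d i = refl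
  ... | no d≢x rewrite update-other (vars σ) i d≢x | update-other (vars τ) i d≢x =
    v (≤∧≢⇒< (≤-pred x≤d) (≢-sym d≢x)) x≢2

-- Lets the value that a search left in variable `d` serve as the value bound by the quantifier.
agree-rebind : ∀ {d σ} → Agree (suc d) (setVar σ d (vars σ d)) σ
agree-rebind {d} {σ} = agree w (λ _ → refl)
  where
  w : ∀ {x} → x < suc d → x ≢ 2 → vars (setVar σ d (vars σ d)) x ≡ vars σ x
  w {x} _ _ with d ≟ x
  ... | yes refl = update-same (vars σ) d _
  ... | no d≢x   = update-other (vars σ) _ d≢x

T-<∧≢2 : ∀ x d → T ((x <ᵇ d) ∧ not (x ≡ᵇ 2)) → x < d × x ≢ 2
T-<∧≢2 x d t with x <ᵇ d in lt | x ≡ᵇ 2 in e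
... | true | false = <ᵇ⇒< x d (subst T (sym lt) _) , λ { refl → contradiction e λ () }

T-≢3 : ∀ a → T (not (a ≡ᵇ 3)) → a ≢ 3
T-≢3 .3 () refl

eval-agree : ∀ {d σ τ} → Agree d σ τ → ∀ e → Scopedᵉ d e → eval σ e ≡ eval τ e
eval-agree A (lit k)   s = refl
eval-agree {d} A (var x)   s with p , q ← T-<∧≢2 x d s = sameVars A p q
eval-agree {τ = τ} A (a [ e ]) (s , t)
  rewrite sameArrays A (T-≢3 a s) = cong (arrays τ a) (eval-agree A e t)
eval-agree A (e ⊕ f) (s , t) = cong₂ _+_ (eval-agree A e s) (eval-agree A f t)
eval-agree A (e ⊖ f) (s , t) = cong₂ _∸_ (eval-agree A e s) (eval-agree A f t)

size-agree : ∀ {d σ τ} → 3 ≤ d → Agree d σ τ → ∀ r →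
             size r (vars σ 0) (vars σ 1) ≡ size r (vars τ 0) (vars τ 1)
size-agree 3≤d A r =
  cong₂ (size r) (sameVars A (≤-trans (s≤s z≤n) 3≤d) λ ())
                 (sameVars A (≤-trans (s≤s (s≤s z≤n)) 3≤d) λ ())

⟦⟧-agree : ∀ φ {d σ τ} → 3 ≤ d → Scoped d φ → Agree d σ τ →
           ⟦ φ ⟧ d σ → ⟦ φ ⟧ d τ
⟦⟧-agree (a ≐ b) _ (s , t) A p =
  trans (sym (eval-agree A a s)) (trans p (eval-agree A b t))
⟦⟧-agree (a ≼ b) _ (s , t) A p
  rewrite eval-agree A a s | eval-agree A b t = p
⟦⟧-agree (φ ⋏ ψ) d≥3 (s , t) A (p , q) =
  ⟦⟧-agree φ d≥3 s A p , ⟦⟧-agree ψ d≥3 t A q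
⟦⟧-agree (φ ⋎ ψ) d≥3 (s , t) A (inj₁ p) = inj₁ (⟦⟧-agree φ d≥3 s A p)
⟦⟧-agree (φ ⋎ ψ) d≥3 (s , t) A (inj₂ q) = inj₂ (⟦⟧-agree ψ d≥3 t A q)
⟦⟧-agree (∼ φ) d≥3 s A ¬p p = ¬p (⟦⟧-agree φ d≥3 s (agree-sym A) p)
⟦⟧-agree (some r φ) d≥3 s A (i , i<N , p) =
  i , subst (i <_) (size-agree d≥3 A r) i<N ,
  ⟦⟧-agree φ (m≤n⇒m≤1+n d≥3) s (agree-bind A refl) p

-- Correctness and cost of compiled tests

Witnessed : Test → ℕ → State → Set
Witnessed (some r φ) d σ =
  vars σ d < size r (vars σ 0) (vars σ 1) × Witnessed φ (suc d) σ
Witnessed φ@(_ ≐ _) = ⟦ φ ⟧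
Witnessed φ@(_ ≼ _) = ⟦ φ ⟧
Witnessed φ@(_ ⋏ _) = ⟦ φ ⟧
Witnessed φ@(_ ⋎ _) = ⟦ φ ⟧
Witnessed φ@(∼ _)   = ⟦ φ ⟧

witnessed⇒holds : ∀ φ {d σ} → 3 ≤ d → Scoped d φ →
                  Witnessed φ d σ → ⟦ φ ⟧ d σ
witnessed⇒holds (some r φ) d≥3 s (i<N , w) =
  _ , i<N , ⟦⟧-agree φ d≥4 s (agree-sym agree-rebind)
              (witnessed⇒holds φ d≥4 s w)
  where d≥4 = m≤n⇒m≤1+n d≥3
witnessed⇒holds (_ ≐ _) _ _ p = p
witnessed⇒holds (_ ≼ _) _ _ p = p
witnessed⇒holds (_ ⋏ _) _ _ p = p
witnessed⇒holds (_ ⋎ _) _ _ p = p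
witnessed⇒holds (∼ _)   _ _ p = p

Verdict : Test → ℕ → State → State → Set
Verdict φ d σ σ′ = (vars σ′ 2 ≡ 1 × Witnessed φ d σ′)
                 ⊎ (vars σ′ 2 ≡ 0 × ¬ ⟦ φ ⟧ d σ)

record Decides (φ : Test) (d : ℕ) (P : Prog) (T : ℕ) (σ : State) : Set where
  constructor decides
  field
    {final} : State
    {steps} : ℕ
    run     : ⟨ P , σ ⟩⇓⟨ final , steps ⟩
    inTime  : steps ≤ T
    frame   : ∀ {x} → x < d → x ≢ 2 → vars final x ≡ vars σ x
    memory  : arrays final ≡ arrays σ
    verdict : Verdict φ d σ final

  agreement : Agree d final σ
  agreement = agree frame λ {a} _ → cong (λ f → f a) memory

1≢0 : ∀ {k} → k ≡ 1 → k ≢ 0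
1≢0 refl ()

module _ {d : ℕ} (d≥3 : 3 ≤ d) where

  d≢ : ∀ {x} → x < 3 → d ≢ x
  d≢ x<3 refl = <-irrefl refl (<-≤-trans x<3 d≥3)

  0<d : 0 < d
  0<d = ≤-trans (s≤s z≤n) d≥3

  1<d : 1 < d
  1<d = ≤-trans (s≤s (s≤s z≤n)) d≥3

  eval-bound : ∀ r σ → eval σ (bound r) ≡ size r (vars σ 0) (vars σ 1)
  eval-bound vertices σ = refl
  eval-bound edges    σ = refl
  eval-bound levels   σ = refl

  module Search (r : Range) (φ : Test) (s : Scoped (suc d) φ) (σ₀ : State)
    (body : ∀ σ → Decides φ (suc d) (decide φ (suc d))
                    (time φ (vars σ 0) (vars σ 1)) σ) where

    n = vars σ₀ 0
    m = vars σ₀ 1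
    N = size r n m

    loopBody = decide φ (suc d) ⨟ ifnz var 2 then skip else d ≔ var d ⊕ lit 1

    step = suc (cost (searching r d)) + (time φ n m + 6)

    Found : ℕ → State → Set
    Found f σ =
      ∃[ σ′ ] ∃[ t ] ⟨ whilenz searching r d loop loopBody , σ ⟩⇓⟨ σ′ , t ⟩
        × t ≤ f * step + suc (cost (searching r d))
        × (∀ {x} → x < d → x ≢ 2 → vars σ′ x ≡ vars σ₀ x)
        × arrays σ′ ≡ arrays σ₀
        × Verdict (some r φ) d σ₀ σ′

    -- Induction on the number `f` of candidates left. `fails` speaks of the fixed state `σ₀`, not
    -- of the changing `σ`, so on exhaustion it refutes the existential there.
    search : ∀ f {σ i} → i + f ≡ N → vars σ d ≡ i → vars σ 2 ≡ 0 →
      (∀ {x} → x < d → x ≢ 2 → vars σ x ≡ vars σ₀ x) →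
      arrays σ ≡ arrays σ₀ →
      (∀ j → j < i → ¬ ⟦ φ ⟧ (suc d) (setVar σ₀ d j)) →
      Found f σ
    search f {σ} {i} i+f≡N d≡i z≡0 fr ar fails = go f i+f≡N
      where
      N≡ : eval σ (bound r) ≡ N
      N≡ = trans (eval-bound r σ) (cong₂ (size r) (fr 0<d λ ()) (fr 1<d λ ()))
      i+k∸i : ∀ {k} → i + k ≡ N → N ∸ i ≡ k
      i+k∸i {k} e = trans (cong (_∸ i) (sym e)) (m+n∸m≡n i k)
      go : ∀ f → i + f ≡ N → Found f σ
      go zero e = σ , _ , ⇓exit stop , ≤-refl , fr , ar ,
        inj₂ (z≡0 , λ (j , j<N , p) → fails j (subst (j <_) (trans (sym e) (+-identityʳ i)) j<N) p)
        where
        stop : eval σ (searching r d) ≡ 0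
        stop rewrite z≡0 | N≡ | d≡i | i+k∸i e = refl
      go (suc f) e = continue (body σ)
        where
        i<N : i < N
        i<N = subst (i <_) e (m<m+n i (s≤s z≤n))
        running : eval σ (searching r d) ≢ 0
        running rewrite z≡0 | N≡ | d≡i | i+k∸i e | 0∸n≡0 f = λ ()
        σ≈ : Agree (suc d) σ (setVar σ₀ d i)
        σ≈ = agree-trans (agree-sym (agree-rebind {d} {σ}))
               (agree-bind (agree fr λ {a} _ → cong (λ f → f a) ar) d≡i)
        time≡ : time φ (vars σ 0) (vars σ 1) ≡ time φ n m
        time≡ = cong₂ (time φ) (fr 0<d λ ()) (fr 1<d λ ())
        continue : Decides φ (suc d) (decide φ (suc d)) (time φ (vars σ 0) (vars σ 1)) σ →
                   Found (suc f) σ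
        continue (decides {σ₁} {t₁} run₁ t₁≤ fr₁ ar₁ (inj₁ (z≡1 , w))) =
          σ₁ , _ ,
          ⇓loop running (⇓seq run₁ (⇓then (1≢0 z≡1) ⇓skip)) (⇓exit stop) ,
          bnd , fr′ , trans ar₁ ar , inj₁ (z≡1 , inRange , w)
          where
          -- Variable 2 is 1, which stops the loop; the branch taken was `skip`, so `d` still holds
          -- the witness.
          stop : eval σ₁ (searching r d) ≡ 0
          stop rewrite z≡1 = 0∸n≡0 (1 ∸ (eval σ₁ (bound r) ∸ vars σ₁ d))
          fr′ : ∀ {x} → x < d → x ≢ 2 → vars σ₁ x ≡ vars σ₀ x
          fr′ p q = trans (fr₁ (m≤n⇒m≤1+n p) q) (fr p q)
          inRange : vars σ₁ d < size r (vars σ₁ 0) (vars σ₁ 1)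
          inRange rewrite fr′ 0<d (λ ()) | fr′ 1<d (λ ())
                        | fr₁ ≤-refl (d≢ ≤-refl) | d≡i = i<N
          C = suc (cost (searching r d))
          bnd : C + ((t₁ + 3) + C) ≤ suc f * step + C
          bnd = begin
            C + ((t₁ + 3) + C)           ≡⟨ sym (+-assoc C (t₁ + 3) C) ⟩
            (C + (t₁ + 3)) + C           ≤⟨ +-monoˡ-≤ C (+-monoʳ-≤ C
                                              (+-mono-≤ (≤-trans t₁≤ (≤-reflexive time≡)) (m≤m+n 3 3))) ⟩
            step + C                     ≤⟨ +-monoˡ-≤ C (m≤m+n step (f * step)) ⟩
            suc f * step + C             ∎
            where open ≤-Reasoning
        continue (decides {σ₁} {t₁} run₁ t₁≤ fr₁ ar₁ (inj₂ (z₁≡0 , ¬p))) =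
          let σ′ , t , run , t≤ , rest = search f {σ₂} {suc i}
                (trans (sym (+-suc i f)) e) d₂ z₂ fr₂ (trans ar₁ ar) fails′
          in σ′ , _ , ⇓loop running (⇓seq run₁ (⇓else z₁≡0 ⇓var)) run , bnd t≤ , rest
          where
          σ₂ = setVar σ₁ d (vars σ₁ d + 1)
          d₂ : vars σ₂ d ≡ suc i
          d₂ rewrite update-same (vars σ₁) d (vars σ₁ d + 1)
                   | fr₁ ≤-refl (d≢ ≤-refl) | d≡i = +-comm i 1
          z₂ : vars σ₂ 2 ≡ 0
          z₂ rewrite update-other (vars σ₁) (vars σ₁ d + 1) (d≢ (≤-refl {3})) = z₁≡0
          fr₂ : ∀ {x} → x < d → x ≢ 2 → vars σ₂ x ≡ vars σ₀ x
          fr₂ p q rewrite update-other (vars σ₁) (vars σ₁ d + 1) (≢-sym (<⇒≢ p)) =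
            trans (fr₁ (m≤n⇒m≤1+n p) q) (fr p q)
          fails′ : ∀ j → j < suc i → ¬ ⟦ φ ⟧ (suc d) (setVar σ₀ d j)
          fails′ j j<1+i p with j ≟ i
          ... | yes refl = ¬p (⟦⟧-agree φ (m≤n⇒m≤1+n d≥3) s (agree-sym σ≈) p)
          ... | no  j≢i  = fails j (≤∧≢⇒< (≤-pred j<1+i) j≢i) p
          C = suc (cost (searching r d))
          bnd : ∀ {t} → t ≤ f * step + C → C + ((t₁ + 6) + t) ≤ suc f * step + C
          bnd {t} t≤ = begin
            C + ((t₁ + 6) + t)             ≡⟨ sym (+-assoc C (t₁ + 6) t) ⟩
            (C + (t₁ + 6)) + t             ≤⟨ +-mono-≤ (+-monoʳ-≤ C
                                                (+-monoˡ-≤ 6 (≤-trans t₁≤ (≤-reflexive time≡)))) t≤ ⟩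
            step + (f * step + C)          ≡⟨ sym (+-assoc step (f * step) C) ⟩
            suc f * step + C               ∎
            where open ≤-Reasoning

-- Structural induction on the test. `3 ≤ d` keeps binders away from the loop bounds in variables 0
-- and 1 and from the verdict in variable 2.
decide-correct : ∀ φ {d} → 3 ≤ d → Scoped d φ → ∀ σ →
  Decides φ d (decide φ d) (time φ (vars σ 0) (vars σ 1)) σ
decide-correct (a ≐ b) {d} d≥3 s σ =
  decides ⇓var ≤-refl (λ _ x≢2 → update-other (vars σ) _ (≢-sym x≢2)) refl v
  where
  x = eval σ a
  y = eval σ b
  v : Verdict (a ≐ b) d σ (setVar σ 2 (1 ∸ ((x ∸ y) + (y ∸ x))))
  v with x ≟ y
  ... | yes e = inj₁ (cong₂ (λ j k → 1 ∸ (j + k)) (m≤n⇒m∸n≡0 (≤-reflexive e))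
                                             (m≤n⇒m∸n≡0 (≤-reflexive (sym e))) ,
                     ⟦⟧-agree (a ≐ b) d≥3 s verdict-agree e)
    where
    verdict-agree = agree (λ _ x≢2 → sym (update-other (vars σ) _ (≢-sym x≢2))) (λ _ → refl)
  -- If both truncated differences vanished, the two values would be equal by antisymmetry.
  ... | no ne = inj₂ (m≤n⇒m∸n≡0 (n≢0⇒n>0 λ z → ne (≤-antisym
                        (m∸n≡0⇒m≤n (m+n≡0⇒m≡0 (x ∸ y) z))
                        (m∸n≡0⇒m≤n (m+n≡0⇒n≡0 (x ∸ y) z)))) , ne)
decide-correct (a ≼ b) {d} d≥3 s σ =
  decides ⇓var ≤-refl (λ _ x≢2 → update-other (vars σ) _ (≢-sym x≢2)) refl v
  where
  x = eval σ a
  y = eval σ b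
  v : Verdict (a ≼ b) d σ (setVar σ 2 (1 ∸ (x ∸ y)))
  v with x ≤? y
  ... | yes p = inj₁ (cong (1 ∸_) (m≤n⇒m∸n≡0 p) ,
                     ⟦⟧-agree (a ≼ b) d≥3 s verdict-agree p)
    where
    verdict-agree = agree (λ _ x≢2 → sym (update-other (vars σ) _ (≢-sym x≢2))) (λ _ → refl)
  ... | no ¬p = inj₂ (m≤n⇒m∸n≡0 (m<n⇒0<n∸m (≰⇒> ¬p)) , ¬p)
decide-correct (φ ⋏ ψ) {d} d≥3 (s , t) σ
  with D@(decides {σ₁} {t₁} run₁ t₁≤ fr₁ ar₁ v₁) ← decide-correct φ d≥3 s σ
  with v₁
... | inj₂ (z≡0 , ¬p) =
  decides (⇓seq run₁ (⇓else z≡0 ⇓skip))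
          (+-mono-≤ t₁≤ (s≤s (s≤s (s≤s z≤n)))) fr₁ ar₁
          (inj₂ (z≡0 , ¬p ∘ proj₁))
... | inj₁ (z≡1 , w)
  with D′@(decides run₂ t₂≤ fr₂ ar₂ v₂) ← decide-correct ψ d≥3 t σ₁ =
  decides (⇓seq run₁ (⇓then (1≢0 z≡1) run₂))
          (+-mono-≤ t₁≤ (≤-trans (+-monoʳ-≤ 2 (≤-trans t₂≤ (≤-reflexive time≡))) (n≤1+n _)))
          (λ p q → trans (fr₂ p q) (fr₁ p q)) (trans ar₂ ar₁) (v v₂)
  where
  time≡ = cong₂ (time ψ) (fr₁ (0<d d≥3) λ ()) (fr₁ (1<d d≥3) λ ())
  A₁ = Decides.agreement D
  v : Verdict ψ d σ₁ _ → Verdict (φ ⋏ ψ) d σ _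
  v (inj₁ (z , w₂)) = inj₁ (z ,
    ⟦⟧-agree φ d≥3 s (agree-sym (Decides.agreement D′)) (witnessed⇒holds φ d≥3 s w) ,
    witnessed⇒holds ψ d≥3 t w₂)
  v (inj₂ (z , ¬q)) = inj₂ (z , ¬q ∘ ⟦⟧-agree ψ d≥3 t (agree-sym A₁) ∘ proj₂)
decide-correct (φ ⋎ ψ) {d} d≥3 (s , t) σ
  with D@(decides {σ₁} {t₁} run₁ t₁≤ fr₁ ar₁ v₁) ← decide-correct φ d≥3 s σ
  with v₁
... | inj₁ (z≡1 , w) =
  decides (⇓seq run₁ (⇓then (1≢0 z≡1) ⇓skip))
          (+-mono-≤ t₁≤ (s≤s (s≤s (s≤s z≤n)))) fr₁ ar₁
          (inj₁ (z≡1 , inj₁ (witnessed⇒holds φ d≥3 s w)))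
... | inj₂ (z≡0 , ¬p)
  with D′@(decides run₂ t₂≤ fr₂ ar₂ v₂) ← decide-correct ψ d≥3 t σ₁ =
  decides (⇓seq run₁ (⇓else z≡0 run₂))
          (+-mono-≤ t₁≤ (≤-trans (+-monoʳ-≤ 2 (≤-trans t₂≤ (≤-reflexive time≡))) (n≤1+n _)))
          (λ p q → trans (fr₂ p q) (fr₁ p q)) (trans ar₂ ar₁) (v v₂)
  where
  time≡ = cong₂ (time ψ) (fr₁ (0<d d≥3) λ ()) (fr₁ (1<d d≥3) λ ())
  A₁ = Decides.agreement D
  v : Verdict ψ d σ₁ _ → Verdict (φ ⋎ ψ) d σ _
  v (inj₁ (z , w₂)) = inj₁ (z , inj₂ (witnessed⇒holds ψ d≥3 t w₂))
  v (inj₂ (z , ¬q)) = inj₂ (z , λ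
    { (inj₁ p) → ¬p p
    ; (inj₂ q) → ¬q (⟦⟧-agree ψ d≥3 t (agree-sym A₁) q) })
decide-correct (∼ φ) {d} d≥3 s σ
  with D@(decides {σ₁} {t₁} run₁ t₁≤ fr₁ ar₁ v₁) ← decide-correct φ d≥3 s σ =
  decides (⇓seq run₁ ⇓var) (+-monoˡ-≤ 4 t₁≤)
          (λ p q → trans (update-other (vars σ₁) _ (≢-sym q)) (fr₁ p q)) ar₁ (v v₁)
  where
  A : Agree d (setVar σ₁ 2 (1 ∸ vars σ₁ 2)) σ
  A = agree (λ p q → trans (update-other (vars σ₁) _ (≢-sym q)) (fr₁ p q))
            (sameArrays (Decides.agreement D))
  v : Verdict φ d σ σ₁ → Verdict (∼ φ) d σ (setVar σ₁ 2 (1 ∸ vars σ₁ 2))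
  v (inj₁ (z≡1 , w))  = inj₂ (cong (1 ∸_) z≡1 , λ ¬p →
    ¬p (⟦⟧-agree φ d≥3 s (Decides.agreement D) (witnessed⇒holds φ d≥3 s w)))
  v (inj₂ (z≡0 , ¬p)) = inj₁ (cong (1 ∸_) z≡0 , ⟦⟧-agree (∼ φ) d≥3 s (agree-sym A) ¬p)
decide-correct (some r φ) {d} d≥3 s σ =
  let σ′ , t , run , t≤ , fr , ar , v =
        search (size r (vars σ 0) (vars σ 1)) {σ₂} {0} refl
          (trans (update-other (vars σ₁) 0 (≢-sym (d≢ d≥3 (≤-refl {3}))))
                 (update-same (vars σ) d 0))
          refl fr₂ refl (λ _ ())
  in decides (⇓seq ⇓var (⇓seq ⇓var run)) (+-monoʳ-≤ 4 t≤) fr ar v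
  where
  open Search d≥3 r φ s σ (decide-correct φ (m≤n⇒m≤1+n d≥3) s)
  σ₁ = setVar σ d 0
  σ₂ = setVar σ₁ 2 0
  fr₂ : ∀ {x} → x < d → x ≢ 2 → vars σ₂ x ≡ vars σ x
  fr₂ p q = trans (update-other (vars σ₁) 0 (≢-sym q))
                  (update-other (vars σ) 0 (≢-sym (<⇒≢ p)))

-- The auction and its optimality

unique-lookup-injective : ∀ {A : Set} {xs : List A} → Unique xs → ∀ i j →
                   lookup xs i ≡ lookup xs j → i ≡ j
unique-lookup-injective (x∉ ∷ u) zero    zero    e = refl
unique-lookup-injective (x∉ ∷ u) zero    (suc j) e = contradiction e (All.lookup x∉ (∈-lookup j))
unique-lookup-injective (x∉ ∷ u) (suc i) zero    e = contradiction (sym e) (All.lookup x∉ (∈-lookup i))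
unique-lookup-injective (x∉ ∷ u) (suc i) (suc j) e = cong suc (unique-lookup-injective u i j e)

module _ {n : ℕ} {P Q : Fin n → Set} (P? : Decidable P) (Q? : Decidable Q) where

  -- `total` picks a partner for each listed element and `functional` forbids sharing one, so
  -- positions in the first list inject into positions in the second.
  injection⇒≤ : (R : Fin n → Fin n → Set) →
    (∀ {u} → P u → ∃[ w ] Q w × R u w) →
    (∀ {u u′ w} → R u w → R u′ w → u ≡ u′) →
    length (filter P? (allFin n)) ≤ length (filter Q? (allFin n))
  injection⇒≤ R total functional = injective⇒≤ {f = index} index-injective
    where
    ps = filter P? (allFin n)
    qs = filter Q? (allFin n)
    holds : ∀ i → P (lookup ps i)
    holds i = proj₂ (∈-filter⁻ P? {xs = allFin n} (∈-lookup i))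
    image : ∀ i → proj₁ (total (holds i)) ∈ qs
    image i = ∈-filter⁺ Q? (∈-allFin _) (proj₁ (proj₂ (total (holds i))))
    index : Fin (length ps) → Fin (length qs)
    index i = Any.index (image i)
    related : ∀ i → R (lookup ps i) (lookup qs (index i))
    related i = subst (R _) (lookup-index (image i)) (proj₂ (proj₂ (total (holds i))))
    index-injective : ∀ {i j} → index i ≡ index j → i ≡ j
    index-injective {i} {j} e = unique-lookup-injective (filter⁺ P? (allFin⁺ n)) i j
      (functional (related i) (subst (λ k → R _ (lookup qs k)) (sym e) (related j)))

table-fromℕ< : ∀ {n} (f : Fin n → ℕ) {i} (i<n : i < n) → table f i ≡ f (fromℕ< i<n)
table-fromℕ< {n} f {i} i<n with i <? n
... | yes p = cong f (cong (λ p → fromℕ< p) (<-irrelevant p i<n))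
... | no ¬p = contradiction i<n ¬p

table-toℕ : ∀ {n} (f : Fin n → ℕ) i → table f (toℕ i) ≡ f i
table-toℕ f i = trans (table-fromℕ< f (toℕ<n i)) (cong f (fromℕ<-toℕ i (toℕ<n i)))

-- The conflict graph and the auction invariant

module Auction {n m : ℕ} (G : Graph n m) (c : PartialColoring 2 n) where

  open Graph G

  mem : ℕ → ℕ → ℕ
  mem = arrays (input G c)

  Closed : ℕ → ℕ → Set
  Closed u w = u ≡ w ⊎ (∃[ e ] e < m × ((mem 0 e ≡ u × mem 1 e ≡ w)
                                       ⊎ (mem 0 e ≡ w × mem 1 e ≡ u)))

  -- `Avoids 2 u` means that the precolouring still allows `u` to be happy in colour 1; `Avoids 1 v`
  -- is the same for colour 2.
  Avoids : ℕ → ℕ → Set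
  Avoids i u = ¬ (∃[ w ] w < n × Closed u w × mem 2 w ≡ i)

  Conflict : ℕ → ℕ → Set
  Conflict u v = Avoids 2 u × Avoids 1 v × (∃[ w ] w < n × Closed u w × Closed v w)

  closed⇒adjacent : ∀ u w → Closed (toℕ u) (toℕ w) → u ≡ w ⊎ Adjacent u w
  closed⇒adjacent u w (inj₁ e) = inj₁ (toℕ-injective e)
  closed⇒adjacent u w (inj₂ (e , e<m , j)) = inj₂ (fromℕ< e<m , joins j)
    where
    end : ∀ (f : Fin m → Fin n) {x} → table (toℕ ∘ f) e ≡ toℕ x → f (fromℕ< e<m) ≡ x
    end f p = toℕ-injective (trans (sym (table-fromℕ< (toℕ ∘ f) e<m)) p)
    joins : _ → Joins (fromℕ< e<m) u w
    joins (inj₁ (p , q)) = inj₁ (end end₁ p , end end₂ q)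
    joins (inj₂ (p , q)) = inj₂ (end end₁ p , end end₂ q)

  adjacent⇒closed : ∀ u w → Adjacent u w → Closed (toℕ u) (toℕ w)
  adjacent⇒closed u w (e , j) = inj₂ (toℕ e , toℕ<n e , joins j)
    where
    end : ∀ (f : Fin m → Fin n) {x} → f e ≡ x → table (toℕ ∘ f) (toℕ e) ≡ toℕ x
    end f p = trans (table-toℕ (toℕ ∘ f) e) (cong toℕ p)
    joins : Joins e u w → _
    joins (inj₁ (p , q)) = inj₁ (end end₁ p , end end₂ q)
    joins (inj₂ (p , q)) = inj₂ (end end₁ p , end end₂ q)

  happy⇒constant : ∀ {c′ : Coloring 2 n} {u w} → Happy G c′ u →
                   Closed (toℕ u) (toℕ w) → c′ w ≡ c′ u
  happy⇒constant {u = u} {w} h cl with closed⇒adjacent u w cl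
  ... | inj₁ refl = refl
  ... | inj₂ a    = h w a

  -- The equation is returned so that matching it with `refl` turns a bounded number into the code
  -- of a vertex.
  atℕ : ∀ {i} {P : ℕ → Set} → i < n → P i → ∃[ v ] toℕ v ≡ i × P (toℕ v)
  atℕ {P = P} i<n p = fromℕ< i<n , toℕ-fromℕ< i<n , subst P (sym (toℕ-fromℕ< i<n)) p

  precolored : ∀ w i → c w ≡ just i → mem 2 (toℕ w) ≡ colorCode i
  precolored w i e rewrite table-toℕ (λ v → partialCode (c v)) w | e = refl

  precolored⁻ : ∀ w i → mem 2 (toℕ w) ≡ colorCode i → c w ≡ just i
  precolored⁻ w i e rewrite table-toℕ (λ v → partialCode (c v)) w with c w
  ... | just j = cong just (toℕ-injective (suc-injective e))

  -- A vertex lies in its own closed neighbourhood. Hence an independent set never uses one vertex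
  -- on both sides.
  self-conflict : ∀ {u} → u < n → Avoids 2 u → Avoids 1 u → Conflict u u
  self-conflict u<n a b = a , b , _ , u<n , inj₁ refl , inj₁ refl

  module Extension {c″ : Coloring 2 n} (ext : Extends c″ c) where

    avoids : ∀ {u i j} → Happy G c″ u → c″ u ≡ i → i ≢ j → Avoids (colorCode j) (toℕ u)
    avoids {u} {i} {j} h cu i≢j (w , w<n , cl , cw)
      with v , refl , cl , cw ← atℕ {P = λ w → Closed (toℕ u) w × mem 2 w ≡ colorCode j} w<n (cl , cw) =
      i≢j (trans (sym cu) (trans (sym (happy⇒constant h cl)) (ext v j (precolored⁻ v j cw))))

    -- A common member of the two closed neighbourhoods would carry both colours. With `avoids`, the
    -- happy vertices of any extension form an independent set.
    no-conflict : ∀ {u v} → Happy G c″ u → c″ u ≡ zero → Happy G c″ v → c″ v ≡ suc zero →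
                  ¬ Conflict (toℕ u) (toℕ v)
    no-conflict {u} {v} hu cu hv cv (_ , _ , w , w<n , clu , clv)
      with w , refl , clu , clv ← atℕ {P = λ w → Closed (toℕ u) w × Closed (toℕ v) w} w<n (clu , clv)
      with () ← trans (sym cu) (trans (sym (happy⇒constant hu clu))
                  (trans (happy⇒constant hv clv) cv))

  -- mate v is 0 if v is unmatched and suc u if v is matched to u.
  record Invariant (price mate : ℕ → ℕ) : Set where
    field
      -- A right vertex once matched stays matched, so a positive price certifies a mate.
      idle      : ∀ {v} → v < n → mate v ≡ 0 → price v ≡ 0
      -- The price condition is the ε-complementary slackness of auction algorithms, with ε = 1.
      matched   : ∀ {u v} → v < n → mate v ≡ suc u →
                  u < n × Conflict u v × (∀ {v′} → v′ < n → Conflict u v′ → price v ≤ suc (price v′))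
      injective : ∀ {u v v′} → v < n → v′ < n → mate v ≡ suc u → mate v′ ≡ suc u → v ≡ v′
      bounded   : ∀ {v} → v < n → price v ≤ suc n

  -- The cap `n` before a bid keeps prices at most `suc n` after it. A previous mate of `v` is
  -- displaced and may bid again.
  Enabled : (price mate : ℕ → ℕ) → ℕ → ℕ → Set
  Enabled price mate u v =
    ¬ (∃[ v′ ] v′ < n × mate v′ ≡ suc u) × Conflict u v × price v ≤ n ×
    ¬ (∃[ v′ ] v′ < n × Conflict u v′ × price v′ < price v)

  -- The left half of the independent set. The right half consists of the `v` with `Avoids 1 v` and
  -- `price v ≤ k`; at a gap, `≤` amounts to `<`.
  Chosen : (price : ℕ → ℕ) → ℕ → ℕ → Set
  Chosen price k u = Avoids 2 u × ¬ (∃[ v ] v < n × Conflict u v × price v ≤ k)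

  -- Colour 1 goes where the precolouring or a chosen vertex demands it; colour 2 everywhere else,
  -- for the sake of the right half.
  Red : (price : ℕ → ℕ) → ℕ → ℕ → Set
  Red price k w = mem 2 w ≡ 1 ⊎ (∃[ u ] u < n × Closed u w × Chosen price k u)

  -- Optimality of the colouring read off a stable auction

  module Optimality {price mate : ℕ → ℕ} (inv : Invariant price mate)
    (stable : ∀ {u v} → u < n → v < n → ¬ Enabled price mate u v)
    {k : ℕ} (k≤n : k ≤ n) (gap : ¬ (∃[ v ] v < n × price v ≡ k))
    {c′ : Coloring 2 n}
    (red : ∀ w → (c′ w ≡ zero × Red price k (toℕ w)) ⊎ (c′ w ≡ suc zero × ¬ Red price k (toℕ w)))
    where

    open Invariant inv

    c′-red : ∀ w → Red price k (toℕ w) → c′ w ≡ zero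
    c′-red w r with red w
    ... | inj₁ (e , _)  = e
    ... | inj₂ (_ , ¬r) = contradiction r ¬r

    c′-blue : ∀ w → ¬ Red price k (toℕ w) → c′ w ≡ suc zero
    c′-blue w ¬r with red w
    ... | inj₁ (_ , r) = contradiction r ¬r
    ... | inj₂ (e , _) = e

    extends : Extends c′ c
    extends w zero e = c′-red w (inj₁ (precolored w zero e))
    extends w (suc zero) e = c′-blue w λ
      { (inj₁ e′) → contradiction (trans (sym (precolored w (suc zero) e)) e′) λ ()
      ; (inj₂ (u , _ , cl , av , _)) → av (toℕ w , toℕ<n w , cl , precolored w (suc zero) e) }

    chosen-happy : ∀ u → Chosen price k (toℕ u) → Happy G c′ u
    chosen-happy u ch w a = trans (near w (adjacent⇒closed u w a)) (sym (near u (inj₁ refl)))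
      where
      near : ∀ w → Closed (toℕ u) (toℕ w) → c′ w ≡ zero
      near w cl = c′-red w (inj₂ (toℕ u , toℕ<n u , cl , ch))

    -- A vertex of colour 1 near `v` would be precoloured 1, which `v` avoids, or near a chosen
    -- vertex, which would then have the cheap conflict `v`.
    cheap-happy : ∀ v → Avoids 1 (toℕ v) → price (toℕ v) ≤ k → Happy G c′ v
    cheap-happy v av p≤k w a = trans (near w (adjacent⇒closed v w a)) (sym (near v (inj₁ refl)))
      where
      near : ∀ w → Closed (toℕ v) (toℕ w) → c′ w ≡ suc zero
      near w cl = c′-blue w λ
        { (inj₁ e) → av (toℕ w , toℕ<n w , cl , e)
        ; (inj₂ (u , _ , cl′ , au , none)) →
            none (toℕ v , toℕ<n v , (au , av , toℕ w , toℕ<n w , cl′ , cl) , p≤k) }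

    -- Descent on the price: a conflict priced at most `n` is either cheapest, making a bid enabled
    -- against stability, or undercut by another such conflict.
    unmatched⇒expensive : ∀ {u} → u < n → ¬ (∃[ v ] v < n × mate v ≡ suc u) →
      ∀ {v} → v < n → Acc _<_ (price v) → Conflict u v → ¬ price v ≤ n
    unmatched⇒expensive u<n un v<n (acc rs) cf p≤n = stable u<n v<n
      (un , cf , p≤n , λ (v′ , v′<n , cf′ , lt) →
        unmatched⇒expensive u<n un v′<n (rs lt) cf′ (≤-trans (<⇒≤ lt) p≤n))

    unmatched⇒chosen : ∀ {u} → u < n → Avoids 2 u → ¬ (∃[ v ] v < n × mate v ≡ suc u) →
                       Chosen price k u
    unmatched⇒chosen u<n av un = av , λ (v , v<n , cf , p≤k) →
      unmatched⇒expensive u<n un v<n (<-wellFounded _) cf (≤-trans p≤k k≤n)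

    -- The mate of a right vertex above the gap has all its conflicts at or above
    -- the gap, hence above it.
    matched⇒chosen : ∀ {u v} → v < n → mate v ≡ suc u → k < price v → Chosen price k u
    matched⇒chosen {u} {v} v<n e k<p with matched v<n e
    ... | _ , (av , _) , low = av , λ (v′ , v′<n , cf , p≤k) →
      gap (v′ , v′<n , ≤-antisym p≤k (≤-pred (≤-trans k<p (low v′<n cf))))

    module _ {c″ : Coloring 2 n} (ext : Extends c″ c) where

      open Extension ext

      -- Matching edges send the happy vertices of c″ injectively to those of c′.
      data Image (u w : Fin n) : Set where
        left  : c″ u ≡ zero → Happy G c″ u → Chosen price k (toℕ u) → w ≡ u → Image u w
        right : c″ u ≡ suc zero → Happy G c″ u → price (toℕ u) ≤ k → w ≡ u → Image u w
        cross : c″ u ≡ zero → Happy G c″ u → mate (toℕ w) ≡ suc (toℕ u) →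
                price (toℕ w) ≤ k → Image u w
        back  : c″ u ≡ suc zero → Happy G c″ u → mate (toℕ u) ≡ suc (toℕ w) →
                Chosen price k (toℕ w) → Image u w

      conflict : ∀ (u v : Fin n) → mate (toℕ v) ≡ suc (toℕ u) → Conflict (toℕ u) (toℕ v)
      conflict u v e = proj₁ (proj₂ (matched (toℕ<n v) e))

      mate-avoids : ∀ (u v : Fin n) → mate (toℕ v) ≡ suc (toℕ u) → Avoids 1 (toℕ v)
      mate-avoids u v e = proj₁ (proj₂ (conflict u v e))

      -- By `self-conflict`, `w` would itself be a cheap conflict of the chosen `w`.
      disjoint : ∀ (w : Fin n) → Chosen price k (toℕ w) → Avoids 1 (toℕ w) → ¬ price (toℕ w) ≤ k
      disjoint w (a , none) b p≤k = none (toℕ w , toℕ<n w , self-conflict (toℕ<n w) a b , p≤k)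

      1≢0ᶠ : _≢_ {A = Fin 2} (suc zero) zero
      1≢0ᶠ ()

      -- Two matching edges into the same side coincide because the mates form a matching. The mixed
      -- cases put `w` in both halves, give one vertex two colours, or match two happy vertices of
      -- `c″` although these cannot conflict.
      unique : ∀ u u′ w → Image u w → Image u′ w → u ≡ u′
      unique u u′ w (left _ _ _ refl) (left _ _ _ refl) = refl
      unique u u′ w (left c h _ refl) (right c′ _ _ refl) = contradiction (trans (sym c′) c) 1≢0ᶠ
      unique u u′ w (left _ _ ch refl) (cross _ _ e p≤k) =
        contradiction p≤k (disjoint w ch (mate-avoids u′ w e))
      unique u u′ w (left c h _ refl) (back c′ h′ e _) =
        contradiction (conflict w u′ e) (no-conflict h c h′ c′)
      unique u u′ w (right _ _ _ refl) (right _ _ _ refl) = refl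
      unique u u′ w (right c h _ refl) (cross c′ h′ e _) =
        contradiction (conflict u′ w e) (no-conflict h′ c′ h c)
      unique u u′ w (right c h p≤k refl) (back _ _ _ ch) =
        contradiction p≤k (disjoint w ch (avoids h c 1≢0ᶠ))
      unique u u′ w (cross _ _ e _) (cross _ _ e′ _) =
        toℕ-injective (suc-injective (trans (sym e) e′))
      unique u u′ w (cross _ _ e p≤k) (back _ _ _ ch) =
        contradiction p≤k (disjoint w ch (mate-avoids u w e))
      unique u u′ w (back _ _ e _) (back _ _ e′ _) =
        toℕ-injective (injective (toℕ<n u) (toℕ<n u′) e e′)
      unique u u′ w (right c h _ refl) (left c′ _ _ refl) = contradiction (trans (sym c) c′) 1≢0ᶠ
      unique u u′ w (cross _ _ e p≤k) (left _ _ ch refl) =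
        contradiction p≤k (disjoint w ch (mate-avoids u w e))
      unique u u′ w (back c′ h′ e _) (left c h _ refl) =
        contradiction (conflict w u e) (no-conflict h c h′ c′)
      unique u u′ w (cross c′ h′ e _) (right c h _ refl) =
        contradiction (conflict u w e) (no-conflict h′ c′ h c)
      unique u u′ w (back _ _ _ ch) (right c h p≤k refl) =
        contradiction p≤k (disjoint w ch (avoids h c 1≢0ᶠ))
      unique u u′ w (back _ _ _ ch) (cross _ _ e p≤k) =
        contradiction p≤k (disjoint w ch (mate-avoids u′ w e))

      -- A happy vertex of colour 1 stays put unless its mate is priced at most `k`, and then moves
      -- to that mate. One of colour 2 stays put unless priced above `k`; then it has a mate, by
      -- `idle`, and moves there.
      image : ∀ {u} → Happy G c″ u → ∃[ w ] Happy G c′ w × Image u w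
      image′ : ∀ {u} → Happy G c″ u → ∀ i → c″ u ≡ i → ∃[ w ] Happy G c′ w × Image u w
      image h = image′ h _ refl
      image′ {u} h zero cu with anyUpTo? (λ v → mate v ≟ suc (toℕ u)) n
      ... | no un = u , chosen-happy u ch , left cu h ch refl
        where ch = unmatched⇒chosen (toℕ<n u) (avoids h cu (≢-sym 1≢0ᶠ)) un
      ... | yes (v , v<n , e)
        with x , refl , e ← atℕ {P = λ v → mate v ≡ suc (toℕ u)} v<n e
        with price (toℕ x) ≤? k
      ...   | yes p≤k = x , cheap-happy x (mate-avoids u x e) p≤k , cross cu h e p≤k
      ...   | no  p≰k = u , chosen-happy u ch , left cu h ch refl
        where ch = matched⇒chosen (toℕ<n x) e (≰⇒> p≰k)
      image′ {u} h (suc zero) cu with price (toℕ u) ≤? k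
      ... | yes p≤k = u , cheap-happy u (avoids h cu 1≢0ᶠ) p≤k , right cu h p≤k refl
      ... | no  p≰k with mate (toℕ u) in e
      ...   | zero = contradiction (≤-trans (≤-reflexive (idle (toℕ<n u) e)) z≤n) p≰k
      ...   | suc i
        with i<n , _ ← matched (toℕ<n u) e
        with w , refl , e ← atℕ {P = λ i → mate (toℕ u) ≡ suc i} i<n e =
        w , chosen-happy w ch , back cu h e ch
        where ch = matched⇒chosen (toℕ<n u) e (≰⇒> p≰k)

    optimal : IsOptimal G c c′
    optimal = extends , λ c″ ext →
      injection⇒≤ (happy? G c″) (happy? G c′) (Image ext) (image ext) (unique ext _ _ _)

-- The program

-- The tests mirror Closed, Avoids, Conflict, Enabled and Red so that, at literal
-- depths, ⟦_⟧ unfolds to these predicates. Arrays 4 and 5 hold price and mate.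
-- Variables 3 and 4 are the bidder u and its target v during the auction, then
-- the level k and the vertex being coloured.
closedT : ℕ → ℕ → ℕ → Test
closedT d u w =
  var u ≐ var w ⋎ some edges ((0 [ var d ] ≐ var u ⋏ 1 [ var d ] ≐ var w)
                              ⋎ (0 [ var d ] ≐ var w ⋏ 1 [ var d ] ≐ var u))

avoidsT : ℕ → ℕ → ℕ → Test
avoidsT d i u = ∼ some vertices (closedT (suc d) u d ⋏ 2 [ var d ] ≐ lit i)

conflictT : ℕ → ℕ → ℕ → Test
conflictT d u v = avoidsT d 2 u ⋏ avoidsT d 1 v ⋏
  some vertices (closedT (suc d) u d ⋏ closedT (suc d) v d)

bidT : Test
bidT = ∼ some vertices (5 [ var 5 ] ≐ lit 1 ⊕ var 3) ⋏ conflictT 5 3 4 ⋏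
  4 [ var 4 ] ≼ var 0 ⋏
  -- Strict comparison of prices; with `lit 1` on the left, evaluation yields `suc` definitionally.
  ∼ some vertices (conflictT 6 3 5 ⋏ lit 1 ⊕ 4 [ var 5 ] ≼ 4 [ var 4 ])

enabledT : Test
enabledT = some vertices (some vertices bidT)

gapT : Test
gapT = some levels (∼ some vertices (4 [ var 4 ] ≐ var 3))

redT : Test
redT = 2 [ var 4 ] ≐ lit 1 ⋎ some vertices (closedT 6 5 4 ⋏
  (avoidsT 6 2 5 ⋏ ∼ some vertices (conflictT 7 5 6 ⋏ 4 [ var 6 ] ≼ var 3)))

bid : Prog
bid = 4 [ var 4 ]≔ lit 1 ⊕ 4 [ var 4 ] ⨟ 5 [ var 4 ]≔ lit 1 ⊕ var 3

auction : Prog → Prog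
auction S = whilenz var 2 loop (bid ⨟ S)

paint : Prog → Prog
paint S = whilenz var 0 ⊖ var 4 loop
  (S ⨟ 3 [ var 4 ]≔ lit 2 ⊖ var 2 ⨟ 4 ≔ lit 1 ⊕ var 4)

algorithm : Prog
algorithm = decide enabledT 3 ⨟ auction (decide enabledT 3) ⨟
            decide gapT 3 ⨟ 4 ≔ lit 0 ⨟ paint (decide redT 5)

-- Each 2 tests variable 2, 11 is the cost of `bid`, and `n * suc n` bounds the number of bids.
auctionTime : ℕ → ℕ → ℕ
auctionTime n T = n * suc n * (2 + (11 + T)) + 2

-- The 2 resets variable 4, each 4 is a loop test, and 9 pays for writing a colour and advancing.
paintTime : ℕ → ℕ → ℕ
paintTime n T = 2 + (n * (4 + (T + 9)) + 4)

runtime : ℕ → ℕ → ℕ → ℕ → ℕ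
runtime n T₁ T₂ T₃ = T₁ + (auctionTime n T₁ + (T₂ + paintTime n T₃))

-- The sum of the prices as a potential

total : (ℕ → ℕ) → ℕ → ℕ
total f zero    = 0
total f (suc n) = total f n + f n

total-≤ : ∀ f {b} n → (∀ {v} → v < n → f v ≤ b) → total f n ≤ n * b
total-≤ f zero    h = z≤n
total-≤ f {b} (suc n) h = ≤-trans (+-mono-≤ (total-≤ f n (h ∘ m≤n⇒m≤1+n)) (h ≤-refl))
                                  (≤-reflexive (+-comm (n * b) b))

total-update-≥ : ∀ f {v} a n → n ≤ v → total (update f v a) n ≡ total f n
total-update-≥ f a zero    n≤v = refl
total-update-≥ f a (suc n) n<v =
  cong₂ _+_ (total-update-≥ f a n (<⇒≤ n<v)) (update-other f a (≢-sym (<⇒≢ n<v)))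

-- A bid raises the potential by exactly 1, while `total-≤` caps it at `n * suc n`; this bounds the
-- number of bids.
total-increment : ∀ f {v} n → v < n → total (update f v (suc (f v))) n ≡ suc (total f n)
total-increment f {v} (suc n) v≤n with v ≟ n
... | yes refl rewrite update-same f v (suc (f v)) | total-update-≥ f (suc (f v)) v ≤-refl = +-suc _ _
... | no v≢n rewrite update-other f (suc (f v)) v≢n
                   | total-increment f n (≤∧≢⇒< (≤-pred v≤n) v≢n) = refl

-- Execution of the program

module Run {n m : ℕ} (G : Graph n m) (c : PartialColoring 2 n) where

  open Auction G c

  -- A reference state in which the meanings of the tests reduce to the predicates on `price` and
  -- `mate`.
  std : (price mate : ℕ → ℕ) → State
  std price mate = state (vars (input G c)) (update (update mem 5 mate) 4 price)

  invariant₀ : Invariant (λ _ → 0) (λ _ → 0)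
  invariant₀ = record
    { idle      = λ _ _ → refl
    ; matched   = λ _ ()
    ; injective = λ _ _ ()
    ; bounded   = λ _ → z≤n
    }

  module Bid {price mate : ℕ → ℕ} (inv : Invariant price mate)
    {u v : ℕ} (u<n : u < n) (v<n : v < n) (en : Enabled price mate u v) where

    open Invariant inv

    price′ mate′ : ℕ → ℕ
    price′ = update price v (suc (price v))
    mate′  = update mate v (suc u)

    unmatched = proj₁ en
    cf        = proj₁ (proj₂ en)
    p≤n       = proj₁ (proj₂ (proj₂ en))
    cheapest  = proj₂ (proj₂ (proj₂ en))

    grows : ∀ x → price x ≤ price′ x
    grows x with v ≟ x
    ... | yes refl rewrite update-same price v (suc (price v)) = n≤1+n _
    ... | no v≢x rewrite update-other price (suc (price v)) v≢x = ≤-refl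

    -- Other matched vertices keep their price while the prices they are compared with only grow.
    -- The new pair is slack because `v` was a cheapest conflict before its price rose by 1. As `u`
    -- was unmatched, the mates stay injective.
    invariant : Invariant price′ mate′
    invariant = record { idle = idle′ ; matched = matched′ ; injective = injective′ ; bounded = bounded′ }
      where
      idle′ : ∀ {x} → x < n → mate′ x ≡ 0 → price′ x ≡ 0
      idle′ {x} x<n e with v ≟ x
      ... | yes refl = contradiction (trans (sym (update-same mate v (suc u))) e) λ ()
      ... | no v≢x = trans (update-other price _ v≢x)
                       (idle x<n (trans (sym (update-other mate _ v≢x)) e))
      matched′ : ∀ {y x} → x < n → mate′ x ≡ suc y →
        y < n × Conflict y x × (∀ {v′} → v′ < n → Conflict y v′ → price′ x ≤ suc (price′ v′))
      matched′ {y} {x} x<n e with v ≟ x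
      ... | yes refl with refl ← suc-injective (trans (sym (update-same mate v (suc u))) e)
                     rewrite update-same price v (suc (price v)) =
        u<n , cf , λ {v′} v′<n cf′ →
          s≤s (≤-trans (≮⇒≥ λ lt → cheapest (v′ , v′<n , cf′ , lt)) (grows v′))
      ... | no v≢x rewrite update-other price (suc (price v)) v≢x
        with y<n , cfy , low ← matched x<n (trans (sym (update-other mate _ v≢x)) e) =
        y<n , cfy , λ v′<n cf′ → ≤-trans (low v′<n cf′) (s≤s (grows _))
      old : ∀ {x y} → v ≢ x → mate′ x ≡ y → mate x ≡ y
      old v≢x e = trans (sym (update-other mate _ v≢x)) e
      new : ∀ {y} → mate′ v ≡ suc y → u ≡ y
      new e = suc-injective (trans (sym (update-same mate v (suc u))) e)
      injective′ : ∀ {y x x′} → x < n → x′ < n → mate′ x ≡ suc y → mate′ x′ ≡ suc y → x ≡ x′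
      injective′ {y} {x} {x′} x<n x′<n e e′ with v ≟ x | v ≟ x′
      ... | yes refl | yes refl = refl
      ... | yes refl | no v≢x′ with refl ← new e = contradiction (x′ , x′<n , old v≢x′ e′) unmatched
      ... | no v≢x | yes refl with refl ← new e′ = contradiction (x , x<n , old v≢x e) unmatched
      ... | no v≢x | no v≢x′ = injective x<n x′<n (old v≢x e) (old v≢x′ e′)
      bounded′ : ∀ {x} → x < n → price′ x ≤ suc n
      bounded′ {x} x<n with v ≟ x
      ... | yes refl rewrite update-same price v (suc (price v)) = s≤s p≤n
      ... | no v≢x rewrite update-other price (suc (price v)) v≢x = bounded x<n

  -- Variables 0 and 1 and all arrays but the output are pinned; variables from 3 on remain free for
  -- witnesses.
  record Ready (σ : State) : Set where
    constructor ready
    field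
      agrees : Agree 3 σ (std (arrays σ 4) (arrays σ 5))
      inv    : Invariant (arrays σ 4) (arrays σ 5)

  ready-decide : ∀ {φ P T σ} (D : Decides φ 3 P T σ) → Ready σ → Ready (Decides.final D)
  ready-decide {σ = σ} D (ready A inv) =
    ready (agree-trans (Decides.agreement D)
            (subst (λ f → Agree 3 σ (std (f 4) (f 5))) (sym (Decides.memory D)) A))
          (subst (λ f → Invariant (f 4) (f 5)) (sym (Decides.memory D)) inv)

  3≤3 : 3 ≤ 3
  3≤3 = ≤-refl

  3≤5 : 3 ≤ 5
  3≤5 = m≤m+n 3 2

  Stable : State → Set
  Stable σ = ∀ {u v} → u < n → v < n → ¬ Enabled (arrays σ 4) (arrays σ 5) u v

  bound₅ : ∀ {σ} → Ready σ →
    Agree 5 σ (setVar (setVar (std (arrays σ 4) (arrays σ 5)) 3 (vars σ 3)) 4 (vars σ 4))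
  bound₅ (ready A _) = agree-trans (agree-sym agree-rebind)
    (agree-bind (agree-trans (agree-sym agree-rebind) (agree-bind A refl)) refl)

  witnessed⇒enabled : ∀ {σ} → Ready σ → Witnessed enabledT 3 σ →
    vars σ 3 < n × vars σ 4 < n × Enabled (arrays σ 4) (arrays σ 5) (vars σ 3) (vars σ 4)
  witnessed⇒enabled {σ} R (u<n , v<n , w) =
    subst (vars σ 3 <_) n≡ u<n , subst (vars σ 4 <_) n≡ v<n , ⟦⟧-agree bidT 3≤5 _ (bound₅ R) w
    where
    n≡ : vars σ 0 ≡ n
    n≡ = sameVars (Ready.agrees R) (s≤s z≤n) λ ()

  enabled⇒holds : ∀ {p q u v} → u < n → v < n → Enabled p q u v → ⟦ enabledT ⟧ 3 (std p q)
  enabled⇒holds u<n v<n en = _ , u<n , _ , v<n , en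

  -- An arbitrary test φ in place of enabledT, whose program is too large to unfold.
  module Loop (φ : Test) (T : ℕ)
    (search   : ∀ {σ} → Ready σ → Decides φ 3 (decide φ 3) T σ)
    (sound    : ∀ {σ} → Ready σ → Witnessed φ 3 σ → vars σ 3 < n × vars σ 4 < n ×
                Enabled (arrays σ 4) (arrays σ 5) (vars σ 3) (vars σ 4))
    (complete : ∀ {σ u v} → Ready σ → u < n → v < n →
                Enabled (arrays σ 4) (arrays σ 5) u v → ⟦ φ ⟧ 3 σ)
    where

    round = 2 + (11 + T)

    Stabilised : ℕ → State → Set
    Stabilised f σ =
      ∃[ σ′ ] ∃[ t ] ⟨ auction (decide φ 3) , σ ⟩⇓⟨ σ′ , t ⟩ ×
        t ≤ f * round + 2 × Ready σ′ × Stable σ′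

    decide-ready : ∀ {P T σ} (D : Decides φ 3 P T σ) → Ready σ →
      Ready (Decides.final D) ×
      ((vars (Decides.final D) 2 ≡ 1 × Witnessed φ 3 (Decides.final D)) ⊎
       (vars (Decides.final D) 2 ≡ 0 × Stable (Decides.final D)))
    decide-ready {σ = σ} D R = ready-decide D R , outcome (Decides.verdict D)
      where
      outcome : Verdict φ 3 σ (Decides.final D) → _
      outcome (inj₁ yep)         = inj₁ yep
      outcome (inj₂ (z≡0 , none)) = inj₂ (z≡0 , λ {u} {v} u<n v<n en →
        none (complete R u<n v<n (subst (λ a → Enabled (a 4) (a 5) u v) (Decides.memory D) en)))

    -- The fuel `f` bounds the bids still possible: each bid spends one unit and adds one to the sum
    -- of the prices.
    stabilise : ∀ f {σ} → Ready σ →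
      ((vars σ 2 ≡ 1 × Witnessed φ 3 σ) ⊎ (vars σ 2 ≡ 0 × Stable σ)) →
      n * suc n ≤ f + total (arrays σ 4) n → Stabilised f σ
    stabilise f {σ} R (inj₂ (z≡0 , stable)) _ =
      σ , 2 , ⇓exit z≡0 , m≤n+m 2 (f * round) , R , stable
    stabilise f {σ} R@(ready A inv) (inj₁ (z≡1 , w)) fuel
      with u<n , v<n , en ← sound R w = continue f fuel
      where
      module After = Bid inv u<n v<n en
      u = vars σ 3
      v = vars σ 4
      σ₁ = setArray σ 4 v (suc (arrays σ 4 v))
      σ₂ = setArray σ₁ 5 v (suc u)
      ready₂ : Ready σ₂
      ready₂ = ready (agree (sameVars A) arr) After.invariant
        where
        arr : ∀ {a} → a ≢ 3 → arrays σ₂ a ≡ arrays (std After.price′ After.mate′) a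
        arr {0} a≢3 = sameArrays A a≢3
        arr {1} a≢3 = sameArrays A a≢3
        arr {2} a≢3 = sameArrays A a≢3
        arr {3} a≢3 = contradiction refl a≢3
        arr {4} a≢3 = refl
        arr {5} a≢3 = refl
        arr {suc (suc (suc (suc (suc (suc a)))))} a≢3 = sameArrays A a≢3
      increment : total After.price′ n ≡ suc (total (arrays σ 4) n)
      increment = total-increment (arrays σ 4) n v<n
      continue : ∀ f → n * suc n ≤ f + total (arrays σ 4) n → Stabilised f σ
      -- Without fuel the sum already reaches `n * suc n`, and the bid would push it past its cap.
      continue zero fuel = contradiction
        (≤-trans (≤-reflexive (sym increment))
          (≤-trans (total-≤ After.price′ n (Invariant.bounded After.invariant)) fuel))
        1+n≰n
      continue (suc f) fuel =
        let D = search ready₂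
            open Decides D using (run; inTime; memory)
            ready₃ , outcome = decide-ready D ready₂
            σ′ , t , run′ , t≤ , rest = stabilise f ready₃ outcome
              (≤-trans fuel (≤-reflexive (trans (sym (+-suc f _))
                (cong (f +_) (trans (sym increment)
                  (cong (λ a → total (a 4) n) (sym memory)))))))
        in σ′ , _ , ⇓loop (1≢0 z≡1) (⇓seq (⇓seq ⇓array ⇓array) run) run′ ,
           (begin
             2 + ((11 + Decides.steps D) + t)       ≤⟨ +-monoʳ-≤ 2 (+-mono-≤ (+-monoʳ-≤ 11 inTime) t≤) ⟩
             2 + ((11 + T) + (f * round + 2))       ≡⟨ sym (+-assoc round (f * round) 2) ⟩
             suc f * round + 2                      ∎) , rest
        where open ≤-Reasoning

  -- If each of the `n + 1` levels were a price, two would be the price of the same vertex. The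
  -- double negation suffices to exclude a negative verdict on `gapT`.
  gap-exists : ∀ (price : ℕ → ℕ) →
    ¬ ¬ (∃[ k ] k < n + 1 × ¬ (∃[ v ] v < n × price v ≡ k))
  gap-exists price none =
    let i , j , i<j , e = pigeonhole (≤-reflexive (+-comm 1 n)) slot
        same = fromℕ<-injective _ _ _ _ e
        e′   = trans (sym (occupied-price i)) (trans (cong price same) (occupied-price j))
    in <⇒≢ i<j e′
    where
    occupied : ∀ (i : Fin (n + 1)) → ∃[ v ] v < n × price v ≡ toℕ i
    occupied i with anyUpTo? (λ v → price v ≟ toℕ i) n
    ... | yes o = o
    ... | no ¬o = contradiction (toℕ i , toℕ<n i , ¬o) none
    slot : Fin (n + 1) → Fin n
    slot i = fromℕ< (proj₁ (proj₂ (occupied i)))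
    occupied-price : ∀ i → price (proj₁ (occupied i)) ≡ toℕ i
    occupied-price i = proj₂ (proj₂ (occupied i))

  -- The fixed state `τ` supplies the truth values. Painting changes only the output array, the
  -- verdict and variables from 4 on, so agreement with `τ` persists.
  module Painting (φ : Test) (T : ℕ) (τ : State) (τ₀ : vars τ 0 ≡ n)
    (scoped : Scoped 5 φ)
    (search : ∀ {σ} → Agree 4 σ τ → Decides φ 5 (decide φ 5) T σ) where

    Painted : ℕ → ℕ → Set
    Painted x w = (x ≡ 1 × ⟦ φ ⟧ 5 (setVar τ 4 w)) ⊎ (x ≡ 2 × ¬ ⟦ φ ⟧ 5 (setVar τ 4 w))

    step = 4 + (T + 9)

    painting : ∀ f {i σ} → i + f ≡ n → vars σ 4 ≡ i → Agree 4 σ τ →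
      (∀ {w} → w < i → Painted (arrays σ 3 w) w) →
      ∃[ σ′ ] ∃[ t ] ⟨ paint (decide φ 5) , σ ⟩⇓⟨ σ′ , t ⟩ × t ≤ f * step + 4 ×
        (∀ {w} → w < n → Painted (arrays σ′ 3 w) w)
    painting zero {i} {σ} i+0≡n refl A done =
      σ , 4 , ⇓exit stop , ≤-refl , λ w<n → done (subst (_ <_) (sym i≡n) w<n)
      where
      i≡n = trans (sym (+-identityʳ i)) i+0≡n
      stop : vars σ 0 ∸ vars σ 4 ≡ 0
      stop = m≤n⇒m∸n≡0 (≤-reflexive (trans (trans (sameVars A (s≤s z≤n) λ ()) τ₀) (sym i≡n)))
    painting (suc f) {i} {σ} e refl A done =
      let σ′ , t , run′ , t≤ , rest = painting f {suc i} {σ₃} (trans (sym (+-suc i f)) e)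
            (cong suc same₄) A₃ done₃
      in σ′ , _ , ⇓loop running (⇓seq run (⇓seq ⇓array ⇓var)) run′ , (begin
           4 + ((Decides.steps D + 9) + t)  ≤⟨ +-monoʳ-≤ 4 (+-mono-≤ (+-monoˡ-≤ 9 inTime) t≤) ⟩
           4 + ((T + 9) + (f * step + 4))   ≡⟨ sym (+-assoc step (f * step) 4) ⟩
           suc f * step + 4                 ∎) , rest
      where
      open ≤-Reasoning
      D = search A
      open Decides D using (run; inTime; frame; memory; verdict; agreement) renaming (final to σ₁)
      same₄ : vars σ₁ 4 ≡ i
      same₄ = frame ≤-refl λ ()
      σ₂ = setArray σ₁ 3 (vars σ₁ 4) (2 ∸ vars σ₁ 2)
      σ₃ = setVar σ₂ 4 (suc (vars σ₂ 4))
      running : vars σ 0 ∸ vars σ 4 ≢ 0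
      running z = <⇒≱ (subst (i <_) e (m<m+n i (s≤s z≤n)))
        (≤-trans (≤-reflexive (sym (trans (sameVars A (s≤s z≤n) λ ()) τ₀))) (m∸n≡0⇒m≤n z))
      A₃ : Agree 4 σ₃ τ
      A₃ = agree (λ {x} x<4 x≢2 → trans (update-other (vars σ₁) {4} _ (≢-sym (<⇒≢ x<4)))
                   (trans (frame (m≤n⇒m≤1+n x<4) x≢2) (sameVars A x<4 x≢2)))
                 (λ {a} a≢3 → trans (update-other (arrays σ₁) {3} _ (≢-sym a≢3))
                   (trans (cong (λ f → f a) memory) (sameArrays A a≢3)))
      A₅ : Agree 5 σ (setVar τ 4 i)
      A₅ = agree-trans (agree-sym agree-rebind) (agree-bind A refl)
      -- Subtracting the verdict from 2 turns 1 into colour 1 and 0 into colour 2.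
      painted : Painted (2 ∸ vars σ₁ 2) i
      painted with verdict
      ... | inj₁ (z≡1 , w)  = inj₁ (cong (2 ∸_) z≡1 ,
        ⟦⟧-agree φ 3≤5 scoped (agree-trans agreement A₅) (witnessed⇒holds φ 3≤5 scoped w))
      ... | inj₂ (z≡0 , ¬p) = inj₂ (cong (2 ∸_) z≡0 ,
        λ p → ¬p (⟦⟧-agree φ 3≤5 scoped (agree-sym A₅) p))
      done₃ : ∀ {w} → w < suc i → Painted (arrays σ₃ 3 w) w
      done₃ {w} w≤i with i ≟ w
      ... | yes refl rewrite same₄ | update-same (arrays σ₁ 3) i (2 ∸ vars σ₁ 2) = painted
      ... | no i≢w rewrite same₄ | update-other (arrays σ₁ 3) (2 ∸ vars σ₁ 2) i≢w | memory =
        done (≤∧≢⇒< (≤-pred w≤i) (≢-sym i≢w))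

  ready₀ : Ready (input G c)
  ready₀ = ready (agree (λ _ _ → refl) arr) invariant₀
    where
    arr : ∀ {a} → a ≢ 3 → mem a ≡ update (update mem 5 (mem 5)) 4 (mem 4) a
    arr {0} _ = refl
    arr {1} _ = refl
    arr {2} _ = refl
    arr {3} _ = refl
    arr {4} _ = refl
    arr {5} _ = refl
    arr {suc (suc (suc (suc (suc (suc a)))))} _ = refl

  decide-in : ∀ φ {d σ τ} → 3 ≤ d → Scoped d φ → Agree 3 σ τ → vars τ 0 ≡ n → vars τ 1 ≡ m →
              Decides φ d (decide φ d) (time φ n m) σ
  decide-in φ {d} {σ} d≥3 s A τ₀ τ₁ =
    subst (λ T → Decides φ d (decide φ d) T σ)
      (cong₂ (time φ) (trans (sameVars A (s≤s z≤n) λ ()) τ₀)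
                      (trans (sameVars A (s≤s (s≤s z≤n)) λ ()) τ₁))
      (decide-correct φ d≥3 s σ)

  module Bidding = Loop enabledT (time enabledT n m)
    (λ R → decide-in enabledT 3≤3 _ (Ready.agrees R) refl refl)
    witnessed⇒enabled
    (λ R u<n v<n en → ⟦⟧-agree enabledT 3≤3 _ (agree-sym (Ready.agrees R)) (enabled⇒holds u<n v<n en))

  Solution : State → Prog → ℕ → Set
  Solution σ P T = ∃[ σ′ ] ∃[ t ] ∃[ c′ ]
    ⟨ P , σ ⟩⇓⟨ σ′ , t ⟩ × Outputs σ′ c′ × IsOptimal G c c′ × t ≤ T

  solution-seq : ∀ {σ σ′ P Q s S T} → ⟨ P , σ ⟩⇓⟨ σ′ , s ⟩ → s ≤ S →
                 Solution σ′ Q T → Solution σ (P ⨟ Q) (S + T)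
  solution-seq run s≤S (_ , _ , c′ , run′ , out , opt , t≤T) =
    _ , _ , c′ , ⇓seq run run′ , out , opt , +-mono-≤ s≤S t≤T

  agree₄ : ∀ {σ₁ σ₂} → Agree 3 σ₁ σ₂ → ∀ {σ} → Agree 3 σ σ₁ → Agree 4 σ (setVar σ₂ 3 (vars σ 3))
  agree₄ A B = agree-trans (agree-sym agree-rebind) (agree-bind (agree-trans B A) refl)

  coloring : ∀ σ {price k} →
    (∀ {w} → w < n → (arrays σ 3 w ≡ 1 × Red price k w) ⊎ (arrays σ 3 w ≡ 2 × ¬ Red price k w)) →
    ∃[ c′ ] Outputs {2} {n} σ c′ ×
      (∀ w → (c′ w ≡ zero × Red price k (toℕ w)) ⊎ (c′ w ≡ suc zero × ¬ Red price k (toℕ w)))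
  coloring σ {price} {k} painted = (λ w → proj₁ (pick w)) , (λ w → proj₁ (proj₂ (pick w))) ,
                                     (λ w → proj₂ (proj₂ (pick w)))
    where
    pick : ∀ (w : Fin n) → ∃[ i ] arrays σ 3 (toℕ w) ≡ colorCode {2} i ×
           ((i ≡ zero × Red price k (toℕ w)) ⊎ (i ≡ suc zero × ¬ Red price k (toℕ w)))
    pick w with painted (toℕ<n w)
    ... | inj₁ (e , r)  = zero , e , inj₁ (refl , r)
    ... | inj₂ (e , ¬r) = suc zero , e , inj₂ (refl , ¬r)

  finish : ∀ {σ} → Ready σ → Stable σ → ∀ {T} (D : Decides gapT 3 (decide gapT 3) T σ) →
    Verdict gapT 3 σ (Decides.final D) →
    Solution (Decides.final D) (4 ≔ lit 0 ⨟ paint (decide redT 5)) (paintTime n (time redT n m))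
  -- A gap always exists, so this verdict is absurd.
  finish {σ} R stable D (inj₂ (_ , none)) =
    contradiction (λ g → none (⟦⟧-agree gapT 3≤3 _ (agree-sym (Ready.agrees R)) g))
                  (gap-exists (arrays σ 4))
  finish {σ} R stable D (inj₁ (_ , k< , gap)) =
    let σ′ , t , run , t≤ , painted = painting n {0} refl refl A₄ (λ ())
        c′ , out , red = coloring σ′ painted
    in σ′ , _ , c′ , ⇓seq ⇓var run , out ,
       Optimality.optimal (Ready.inv R) stable k≤n
         (⟦⟧-agree (∼ some vertices (4 [ var 4 ] ≐ var 3)) (m≤m+n 3 1) _ A gap) red ,
       +-monoʳ-≤ 2 t≤
    where
    σ₁ = Decides.final D
    k  = vars σ₁ 3
    τ  = setVar (std (arrays σ 4) (arrays σ 5)) 3 k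
    A : Agree 4 σ₁ τ
    A = agree₄ (Ready.agrees R) (Decides.agreement D)
    A₄ : Agree 4 (setVar σ₁ 4 0) τ
    A₄ = agree-trans (agree (λ x<4 _ → update-other (vars σ₁) {4} 0 (≢-sym (<⇒≢ x<4))) (λ _ → refl)) A
    k≤n : k ≤ n
    k≤n = ≤-pred (subst (k <_) (trans (cong (_+ 1) (sameVars A (s≤s z≤n) λ ())) (+-comm n 1)) k<)
    open Painting redT (time redT n m) τ refl _
      (λ {σ′} B → decide-in redT 3≤5 _ (agree (λ x<3 → sameVars B (m≤n⇒m≤1+n x<3)) (sameArrays B)) refl refl)

  stabilised : ∀ {σ} → Bidding.Stabilised (n * suc n) σ →
    Solution σ (auction (decide enabledT 3) ⨟ decide gapT 3 ⨟ 4 ≔ lit 0 ⨟ paint (decide redT 5))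
      (auctionTime n (time enabledT n m) + (time gapT n m + paintTime n (time redT n m)))
  stabilised (σ₂ , t₂ , run₂ , t₂≤ , R₂ , stable) = solution-seq run₂ t₂≤ (search D₃)
    where
    D₃ : Decides gapT 3 (decide gapT 3) (time gapT n m) σ₂
    D₃ = decide-in gapT 3≤3 _ (Ready.agrees R₂) refl refl
    search : (D : Decides gapT 3 (decide gapT 3) (time gapT n m) σ₂) →
      Solution σ₂ (decide gapT 3 ⨟ 4 ≔ lit 0 ⨟ paint (decide redT 5))
        (time gapT n m + paintTime n (time redT n m))
    search D = solution-seq (Decides.run D) (Decides.inTime D)
                 (finish R₂ stable D (Decides.verdict D))

  solve : Solution (input G c) algorithm
            (runtime n (time enabledT n m) (time gapT n m) (time redT n m))
  solve = start (decide-in enabledT 3≤3 _ (Ready.agrees ready₀) refl refl)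
    where
    start : Decides enabledT 3 (decide enabledT 3) (time enabledT n m) (input G c) →
            Solution (input G c) algorithm
              (runtime n (time enabledT n m) (time gapT n m) (time redT n m))
    start D = solution-seq (Decides.run D) (Decides.inTime D)
      (stabilised (Bidding.stabilise (n * suc n) (proj₁ (Bidding.decide-ready D ready₀))
                    (proj₂ (Bidding.decide-ready D ready₀)) (m≤m+n _ _)))

-- Running time

-- The class O(m^b n^a). Arguments are at least 1, so higher powers dominate lower ones and
-- constants.
record Big (b a : ℕ) (f : ℕ → ℕ → ℕ) : Set where
  constructor big
  field
    factor : ℕ
    bounds : ∀ {n m} → 1 ≤ n → 1 ≤ m → f n m ≤ factor * (m ^ b * n ^ a)

big-const : ∀ {b a} k → Big b a (λ _ _ → k)
big-const {b} {a} k = big k bnd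
  where
  bnd : ∀ {n m} → 1 ≤ n → 1 ≤ m → k ≤ k * (m ^ b * n ^ a)
  bnd {suc n} {suc m} _ _ = m≤m*n k (suc m ^ b * suc n ^ a)
    {{m*n≢0 _ _ {{m^n≢0 (suc m) b}} {{m^n≢0 (suc n) a}}}}

big-+ : ∀ {b a f g} → Big b a f → Big b a g → Big b a (λ n m → f n m + g n m)
big-+ {b} {a} (big K p) (big L q) = big (K + L) λ {n} {m} x y →
  ≤-trans (+-mono-≤ (p x y) (q x y)) (≤-reflexive (sym (*-distribʳ-+ (m ^ b * n ^ a) K L)))

big-weaken : ∀ {b a b′ a′ f} → b ≤ b′ → a ≤ a′ → Big b a f → Big b′ a′ f
big-weaken {b} {a} {b′} {a′} {f} b≤ a≤ (big K p) = big K bnd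
  where
  bnd : ∀ {n m} → 1 ≤ n → 1 ≤ m → f n m ≤ K * (m ^ b′ * n ^ a′)
  bnd {suc n} {suc m} x y = ≤-trans (p x y)
    (*-monoʳ-≤ K (*-mono-≤ (^-monoʳ-≤ (suc m) b≤) (^-monoʳ-≤ (suc n) a≤)))

big-n* : ∀ {b a f} → Big b a f → Big b (suc a) (λ n m → n * f n m)
big-n* {b} {a} (big K p) = big K λ {n} {m} x y → ≤-trans (*-monoʳ-≤ n (p x y))
  (≤-reflexive (trans (swap n K _) (cong (K *_) (swap n (m ^ b) (n ^ a)))))
  where swap = x∙yz≈y∙xz *-commutativeSemigroup

big-m* : ∀ {b a f} → Big b a f → Big (suc b) a (λ n m → m * f n m)
big-m* {b} {a} (big K p) = big K λ {n} {m} x y → ≤-trans (*-monoʳ-≤ m (p x y))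
  (≤-reflexive (trans (swap m K _) (cong (K *_) (sym (*-assoc m (m ^ b) (n ^ a))))))
  where swap = x∙yz≈y∙xz *-commutativeSemigroup

big-[n+1]* : ∀ {b a f} → Big b a f → Big b (suc a) (λ n m → (n + 1) * f n m)
big-[n+1]* {f = f} B with big K p ← big-+ (big-n* B) (big-weaken ≤-refl (n≤1+n _) B) = big K λ {n} {m} x y →
  ≤-trans (≤-reflexive (trans (cong (_* f n m) (+-comm n 1)) (+-comm (f n m) _))) (p x y)

edgeLoops vertexLoops : Range → ℕ
edgeLoops edges      = 1
edgeLoops _          = 0
vertexLoops edges    = 0
vertexLoops _        = 1

big-size* : ∀ r {b a f} → Big b a f →
            Big (edgeLoops r + b) (vertexLoops r + a) (λ n m → size r n m * f n m)
big-size* vertices = big-n*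
big-size* edges    = big-m*
big-size* levels   = big-[n+1]*

-- The deepest nesting of edge loops and of the other loops, each maximised on its own; together
-- they bound the time from above.
edgeDegree vertexDegree : Test → ℕ
edgeDegree (_ ≐ _)        = 0
edgeDegree (_ ≼ _)        = 0
edgeDegree (φ ⋏ ψ)        = edgeDegree φ ⊔ edgeDegree ψ
edgeDegree (φ ⋎ ψ)        = edgeDegree φ ⊔ edgeDegree ψ
edgeDegree (∼ φ)          = edgeDegree φ
edgeDegree (some r φ)     = edgeLoops r + edgeDegree φ
vertexDegree (_ ≐ _)      = 0
vertexDegree (_ ≼ _)      = 0
vertexDegree (φ ⋏ ψ)      = vertexDegree φ ⊔ vertexDegree ψ
vertexDegree (φ ⋎ ψ)      = vertexDegree φ ⊔ vertexDegree ψ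
vertexDegree (∼ φ)        = vertexDegree φ
vertexDegree (some r φ)   = vertexLoops r + vertexDegree φ

big-seq : ∀ {b b′ a a′ f g} → Big b a f → Big b′ a′ g →
          Big (b ⊔ b′) (a ⊔ a′) (λ n m → f n m + (3 + g n m))
big-seq {b} {b′} {a} {a′} B B′ =
  big-+ (big-weaken (m≤m⊔n b b′) (m≤m⊔n a a′) B)
        (big-+ (big-const 3) (big-weaken (m≤n⊔m b b′) (m≤n⊔m a a′) B′))

big-search : ∀ r C {b a f} → Big b a f →
  Big (edgeLoops r + b) (vertexLoops r + a) (λ n m → 4 + (size r n m * (C + (f n m + 6)) + C))
big-search r C B =
  big-+ (big-const 4) (big-+ (big-size* r (big-+ (big-const C) (big-+ B (big-const 6)))) (big-const C))

time-degree : ∀ φ → Big (edgeDegree φ) (vertexDegree φ) (time φ)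
time-degree φ@(_ ≐ _)  = big-const (time φ 0 0)
time-degree φ@(_ ≼ _)  = big-const (time φ 0 0)
time-degree (φ ⋏ ψ)    = big-seq (time-degree φ) (time-degree ψ)
time-degree (φ ⋎ ψ)    = big-seq (time-degree φ) (time-degree ψ)
time-degree (∼ φ)      = big-+ (time-degree φ) (big-const 4)
time-degree (some r φ) = big-search r (suc (cost (searching r 0))) (time-degree φ)

auctionTime-degree : ∀ {b a f} → Big b a f → Big b (2 + a) (λ n m → auctionTime n (f n m))
auctionTime-degree {b} {a} {f} B = big (Big.factor rounds) λ {n} {m} x y →
  ≤-trans (≤-reflexive (cong (_+ 2) (trans (*-assoc n (suc n) (13 + f n m))
            (cong (λ k → n * (k * (13 + f n m))) (+-comm 1 n))))) (Big.bounds rounds x y)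
  where
  rounds : Big b (2 + a) (λ n m → n * ((n + 1) * (13 + f n m)) + 2)
  rounds = big-+ (big-n* (big-[n+1]* (big-+ (big-const 13) B))) (big-const 2)

paintTime-degree : ∀ {b a f} → Big b a f → Big b (suc a) (λ n m → paintTime n (f n m))
paintTime-degree B =
  big-+ (big-const 2) (big-+ (big-n* (big-+ (big-const 4) (big-+ B (big-const 9)))) (big-const 4))

runtime-degree : ∀ φ ψ χ {b a} → edgeDegree φ ≤ b → edgeDegree ψ ≤ b → edgeDegree χ ≤ b →
  vertexDegree φ ≤ a → vertexDegree ψ ≤ a → vertexDegree χ ≤ a →
  Big b (2 + a) (λ n m → runtime n (time φ n m) (time ψ n m) (time χ n m))
runtime-degree φ ψ χ p q r s t u =
  big-+ (lift 2 (B φ p s)) (big-+ (auctionTime-degree (B φ p s))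
    (big-+ (lift 2 (B ψ q t)) (lift 1 (paintTime-degree (B χ r u)))))
  where
  B : ∀ φ {b a} → edgeDegree φ ≤ b → vertexDegree φ ≤ a → Big b a (time φ)
  B φ p q = big-weaken p q (time-degree φ)
  lift : ∀ k {b a f} → Big b a f → Big b (k + a) f
  lift k {a = a} = big-weaken ≤-refl (m≤n+m a k)

-- The deepest nesting is in `enabledT`: one edge loop and four vertex loops, within the allowance
-- `a` = 5. The quadratic number of bids adds 2 to the exponent of n.
algorithm-degree : Big 1 7 (λ n m → runtime n (time enabledT n m) (time gapT n m) (time redT n m))
algorithm-degree = runtime-degree enabledT gapT redT
  (≤ᵇ⇒≤ _ _ _) (≤ᵇ⇒≤ _ _ _) (≤ᵇ⇒≤ _ _ _) (≤ᵇ⇒≤ _ _ _) (≤ᵇ⇒≤ _ _ _) (≤ᵇ⇒≤ _ _ _)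

-- The two ends of an edge differ. This makes the logarithm of n at least 1, so that it can be
-- multiplied onto the bound.
edge⇒2≤n : ∀ {n m} → Graph n m → 1 ≤ m → 2 ≤ n
edge⇒2≤n {zero}        G 1≤m with () ← Graph.end₁ G (fromℕ< 1≤m)
edge⇒2≤n {suc zero}    G 1≤m
  with Graph.end₁ G (fromℕ< 1≤m) | Graph.end₂ G (fromℕ< 1≤m) | Graph.loopless G (fromℕ< 1≤m)
... | zero | zero | x≢x = contradiction refl x≢x
edge⇒2≤n {suc (suc n)} G 1≤m = s≤s (s≤s z≤n)

runtime-bound : ∀ {n m} → Graph n m → 1 ≤ m →
  runtime n (time enabledT n m) (time gapT n m) (time redT n m)
    ≤ Big.factor algorithm-degree * (m * n ^ 7 * ⌊log₂ n ⌋)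
runtime-bound {n} {m} G 1≤m =
  ≤-trans (Big.bounds algorithm-degree (<⇒≤ 2≤n) 1≤m) (*-monoʳ-≤ (Big.factor algorithm-degree) (begin
    m ^ 1 * n ^ 7              ≡⟨ cong (_* n ^ 7) (^-identityʳ m) ⟩
    m * n ^ 7                  ≡⟨ sym (*-identityʳ _) ⟩
    m * n ^ 7 * ⌊log₂ 2 ⌋      ≤⟨ *-monoʳ-≤ (m * n ^ 7) (⌊log₂⌋-mono-≤ 2≤n) ⟩
    m * n ^ 7 * ⌊log₂ n ⌋      ∎))
  where
  open ≤-Reasoning
  2≤n = edge⇒2≤n G 1≤m

theorem2p1 : ∃[ P ] ∃[ K ] ∀ (n m : ℕ) (G : Graph n m) (c : PartialColoring 2 n) →
    ∃[ σ ] ∃[ t ] ∃[ c′ ]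
    ⟨ P , input G c ⟩⇓⟨ σ , t ⟩
    × Outputs σ c′
    × IsOptimal G c c′
    × (1 ≤ m → t ≤ K * (m * n ^ 7 * ⌊log₂ n ⌋))
theorem2p1 = algorithm , Big.factor algorithm-degree , λ n m G c →
  let σ , t , c′ , run , outputs , optimal , t≤ = Run.solve G c
  in σ , t , c′ , run , outputs , optimal , λ 1≤m → ≤-trans t≤ (runtime-bound G 1≤m)
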